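{- Let $F$ be a finite field of characteristic $p$ and order $q$, and let $d$ be a positive integer with $\gcd(d,q-1)=1$ such that $d$ is not degenerate over $F$. Then $V_{F,d}\le\frac23[F:\mathbb{F}_p]$.
   Context: $\psi$ is the canonical additive character of $F$, $\psi(x)=e^{2\pi i\operatorname{Tr}(x)/p}$ with $\operatorname{Tr}$ the absolute trace $F\to\mathbb{F}_p$. For $a\in F$, $W_{F,d}(a)=\sum_{x\in F}\psi(x^d-ax)$, and $V_{F,d}=\min_{a\in F}\operatorname{val}_p(W_{F,d}(a))$, where $\operatorname{val}_p$ is the $p$-adic valuation extended to $\mathbb{Q}(e^{2\pi i/p})$ with $\operatorname{val}_p(1-e^{2\pi i/p})=1/(p-1)$ (so $\operatorname{val}_p(p)=1$). The exponent $d$ is degenerate over $F$ if $d$ is congruent to a power of $p$ modulo $q-1$. -}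

module Defs where

open import Level using (0ℓ)
open import Data.Nat as ℕ using (ℕ; zero; suc; _∸_; ∣_-_∣)
open import Data.Nat.Divisibility using (_∣_)
open import Data.Integer as ℤ using (ℤ; +_; -[1+_])
open import Data.Fin using (Fin; toℕ)
open import Data.List using (List; []; _∷_; map; filter; length; replicate; allFin)
open import Data.Product using (∃; ∃-syntax; _×_)
open import Relation.Nullary using (¬_)
open import Relation.Binary.PropositionalEquality using (_≡_)
open import Relation.Binary.Definitions using (DecidableEquality)
open import Algebra.Structures using (IsCommutativeRing)
open import Function.Bundles using (_↔_; Inverse)

record FiniteField : Set₁ where
  infixl 7 _*_
  infixl 6 _+_
  field
    Carrier : Set
    _+_ _*_ : Carrier → Carrier → Carrier
    -_      : Carrier → Carrier
    0# 1#   : Carrier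
    isCommutativeRing : IsCommutativeRing _≡_ _+_ _*_ -_ 0# 1#
    0≢1     : ¬ (0# ≡ 1#)
    inverse : ∀ x → ¬ (x ≡ 0#) → ∃[ y ] (x * y ≡ 1#)
    _≟_     : DecidableEquality Carrier
    size    : ℕ
    enum    : Fin size ↔ Carrier

  pow : Carrier → ℕ → Carrier
  pow x zero    = 1#
  pow x (suc k) = x * pow x k

  embed : ℕ → Carrier
  embed zero    = 0#
  embed (suc m) = 1# + embed m

  elements : List Carrier
  elements = map (Inverse.to enum) (allFin size)

  -- absolute trace F → F_p, for F of degree n over F_p (q = p ^ n):
  -- Tr x = Σ_{i<n} x ^ (p ^ i)
  trace : (p n : ℕ) → Carrier → Carrier
  trace p zero    x = 0#
  trace p (suc i) x = pow x (p ℕ.^ i) + trace p i x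

-- Integer polynomials (coefficient lists, lowest degree first), used to
-- represent Z[ζ_p] = Z[X] / (Φ_p(X)).

Poly : Set
Poly = List ℤ

coeff : Poly → ℕ → ℤ
coeff []      _       = + 0
coeff (a ∷ _) zero    = a
coeff (_ ∷ f) (suc i) = coeff f i

_≋_ : Poly → Poly → Set
f ≋ g = ∀ i → coeff f i ≡ coeff g i

padd : Poly → Poly → Poly
padd []      g       = g
padd f       []      = f
padd (a ∷ f) (b ∷ g) = (a ℤ.+ b) ∷ padd f g

pmul : Poly → Poly → Poly
pmul []      g = []
pmul (a ∷ f) g = padd (map (a ℤ.*_) g) (+ 0 ∷ pmul f g)

ppow : Poly → ℕ → Poly
ppow f zero    = + 1 ∷ []
ppow f (suc k) = pmul f (ppow f k)

oneMinusX : Poly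
oneMinusX = + 1 ∷ -[1+ 0 ] ∷ []

cyclotomic : ℕ → Poly
cyclotomic p = replicate p (+ 1)

-- The element of Z[ζ_p] represented by w is divisible by (1 - ζ_p)^k,
-- i.e. val_p(w) ≥ k / (p - 1)  (1 - ζ_p generates the unique prime of
-- Z[ζ_p] above p, with ramification index p - 1).
PiPowDivides : (p k : ℕ) → Poly → Set
PiPowDivides p k w =
  ∃[ g ] ∃[ h ] (w ≋ padd (pmul (ppow oneMinusX k) g) (pmul (cyclotomic p) h))

-- Weil sums W_{F,d}(a) = Σ_x ψ(x^d - a x) as elements of Z[ζ_p]:
-- the coefficient of ζ_p^m is #{ x ∈ F : Tr(x^d - a x) = m·1 }.

module _ (F : FiniteField) where
  open FiniteField F

  traceCount : (p n d : ℕ) → Carrier → ℕ → ℕ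
  traceCount p n d a m =
    length (filter (λ x → trace p n (pow x d + - (a * x)) ≟ embed m) elements)

  weilSum : (p n d : ℕ) → Carrier → Poly
  weilSum p n d a = map (λ m → + traceCount p n d a (toℕ m)) (allFin p)

_≡_[mod_] : ℕ → ℕ → ℕ → Set
a ≡ b [mod m ] = m ∣ ∣ a - b ∣

Degenerate : (p q d : ℕ) → Set
Degenerate p q d = ∃[ j ] (d ≡ p ℕ.^ j [mod q ∸ 1 ])

{-# OPTIONS --safe #-}

-- Put W(a,b) = Σ_x ψ(b x^d - a x), so that W(a) = W(a,1).  Since d is invertible
-- modulo q - 1, every W(a,b) with b ≠ 0 is some W(a').  By orthogonality
--   Σ_{a,b} W(a,b) W(-a,-Cb) W(-a,-Bb)
-- is q^2 times the number of solutions of x = y + z, x^d = C y^d + B z^d.  If all W(a)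
-- had valuation > 2n/3, this sum would lie in q^2 (π, p), π = 1 - ζ, so the number of
-- solutions would be divisible by p; hence for B, C ≠ 0, C ≠ 1 there is a nontrivial
-- solution, i.e. some t with (t+1)^d = C t^d + B.  Counting pairs (C, t) for fixed
-- B ≠ 0, 1 then leaves no t for C = 1, so (t+1)^d - t^d = 1 for all t.  Writing d = p^a m
-- modulo q - 1 with p ∤ m, also (t+1)^m - t^m - 1 vanishes on F; it has degree m - 1 and
-- leading coefficient m, so m = 1 and d is degenerate.

module Submission where

open import Defs
open import Level using (0ℓ)
open import Algebra.Bundles using (CommutativeRing; CommutativeMonoid; AbelianGroup)
import Algebra.Properties.CommutativeMonoid.Sum
import Algebra.Properties.CommutativeSemigroup
import Algebra.Properties.CommutativeSemiring.Exp
import Algebra.Properties.Ring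
import Algebra.Properties.Semiring.Exp
import Algebra.Properties.Semiring.Mult
import Algebra.Properties.Semiring.Mult.TCOptimised
import Algebra.Properties.Semiring.Sum
import Algebra.Solver.Ring
import Algebra.Solver.Ring.AlmostCommutativeRing as ACR
open import Data.Bool using (if_then_else_)
open import Data.Fin as Fin using (Fin; zero; suc; toℕ; inject₁; fromℕ)
import Data.Fin.Properties as Fin
open import Data.Integer as ℤ using (ℤ)
import Data.Integer.Divisibility.Signed as ℤ
import Data.Integer.Properties as ℤ
open import Data.List using (List; []; _∷_; map; filter; length; tabulate)
open import Data.List.Properties using (map-tabulate; tabulate-cong)
open import Data.Maybe as Maybe using (Maybe)
open import Data.Nat as ℕ using (ℕ; zero; suc; z≤n; s≤s)
import Data.Nat.Combinatorics as ℕ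
import Data.Nat.Combinatorics.Specification as ℕ using (nCk≡n!/k![n-k]!)
open import Data.Nat.Coprimality using (prime⇒coprime; coprime-Bézout)
import Data.Nat.Divisibility as ℕ
import Data.Nat.DivMod as ℕ
open import Data.Nat.GCD using (gcd; GCD; gcd-GCD; gcd-greatest; module Bézout)
open import Data.Nat.Induction using (<-rec)
open import Data.Nat.Primality using (Prime; euclidsLemma; ¬prime[0]; ¬prime[1]; prime⇒nonZero; prime⇒nonTrivial)
import Data.Nat.Properties as ℕ
open import Data.Nat.Solver using (module +-*-Solver)
open import Data.Product using (∃-syntax; ∃₂; _,_; proj₁; proj₂)
open import Data.Sum using (inj₁; inj₂)
open import Data.Vec.Functional using (removeAt)
open import Function using (_∘_; Inverse; Injective; mk↔ₛ′; _↔_)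
open import Function.Properties.Inverse using (↔-sym; ↔-trans)
import Relation.Binary.Reasoning.Setoid
open import Relation.Binary.PropositionalEquality as ≡ using (_≡_; _≢_)
open import Relation.Nullary using (¬_; Dec; yes; no; contradiction; does; ¬?)
open import Relation.Nullary.Decidable using (map′; dec⇒maybe; dec-true; dec-false; decidable-stable)
open import Relation.Unary using (Pred; Decidable)

-- Valuations on Z[ζ] are multiples of 1/(p-1), so V > 2n/3 says that π^K divides every W(a), where
-- K is the least integer with 3K > 2n(p-1). The fraction 2/3 comes from the cube: a product of
-- three such sums is divisible by π^(3K), and since p divides π^(p-1), this yields q² with a factor
-- π left over. That factor excludes an isolated solution: if only x = y = z = 0 solved both
-- equations, the sum would be exactly q², and cancelling q² would put 1 into (π, p). With B and C
-- nonzero, the three second arguments vanish only together with b, and the terms with b = 0 are 0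
-- or q³. The condition C ≠ 1 removes solutions with z = 0.
--
-- In the count for fixed B, t determines C once t ≠ 0, and B ≠ 1 guarantees t ≠ 0: the q - 1 values
-- C ≠ 1 already use up the q - 1 nonzero t.
--
-- Z[ζ] is Z[X] modulo Φ = 1 + X + ... + X^(p-1). Cancelling q² rests on the constant term 1 of Φ,
-- which excludes p-torsion; 1 ∉ (π, p) rests on evaluation at X = 1, where π vanishes and Φ equals
-- p.

module IntegerCoefficientSolver (R : CommutativeRing 0ℓ 0ℓ) where
  open CommutativeRing R
  open import Data.Integer using (+_; -[1+_])
  open Algebra.Properties.Ring ring using (-‿distribˡ-*; -‿involutive; -0#≈0#; -‿+-comm)
  open Algebra.Properties.Semiring.Mult.TCOptimised semiring
  open Relation.Binary.Reasoning.Setoid setoid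

  private
    -- With these multiples `1 × 1#` is `1#` by definition, so `con (+ 0)` and `con (+ 1)` in a
    -- solver equation stand for the ring's own zero and one.
    ⟦_⟧ : ℤ → Carrier
    ⟦ + n ⟧      = n × 1#
    ⟦ -[1+ n ] ⟧ = - (suc n × 1#)

    suc-× : ∀ n → suc n × 1# ≈ 1# + n × 1#
    suc-× n = ×-homo-+ 1# 1 n

    cancel-1+ : ∀ x y → (1# + x) + - (1# + y) ≈ x + - y
    cancel-1+ x y = begin
      (1# + x) + - (1# + y)     ≈⟨ +-cong (+-comm 1# x) (sym (-‿+-comm 1# y)) ⟩
      (x + 1#) + (- 1# + - y)   ≈⟨ +-assoc x 1# _ ⟩
      x + (1# + (- 1# + - y))   ≈⟨ +-congˡ (sym (+-assoc 1# (- 1#) (- y))) ⟩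
      x + ((1# + - 1#) + - y)   ≈⟨ +-congˡ (+-congʳ (-‿inverseʳ 1#)) ⟩
      x + (0# + - y)            ≈⟨ +-congˡ (+-identityˡ (- y)) ⟩
      x + - y                   ∎

    ⊖-homo : ∀ m n → ⟦ m ℤ.⊖ n ⟧ ≈ m × 1# + - (n × 1#)
    ⊖-homo m zero = begin
      m × 1#         ≈⟨ +-identityʳ _ ⟨
      m × 1# + 0#    ≈⟨ +-congˡ -0#≈0# ⟨
      m × 1# + - 0#  ∎
    ⊖-homo zero (suc n) = sym (+-identityˡ _)
    ⊖-homo (suc m) (suc n) = begin
      ⟦ suc m ℤ.⊖ suc n ⟧               ≡⟨ ≡.cong ⟦_⟧ (ℤ.[1+m]⊖[1+n]≡m⊖n m n) ⟩
      ⟦ m ℤ.⊖ n ⟧                       ≈⟨ ⊖-homo m n ⟩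
      m × 1# + - (n × 1#)               ≈⟨ cancel-1+ _ _ ⟨
      (1# + m × 1#) + - (1# + n × 1#)   ≈⟨ +-cong (suc-× m) (-‿cong (suc-× n)) ⟨
      suc m × 1# + - (suc n × 1#)       ∎

    +-homo : ∀ i j → ⟦ i ℤ.+ j ⟧ ≈ ⟦ i ⟧ + ⟦ j ⟧
    +-homo (+ m)    (+ n)    = ×-homo-+ 1# m n
    +-homo (+ m)    -[1+ n ] = ⊖-homo m (suc n)
    +-homo -[1+ m ] (+ n)    = trans (⊖-homo n (suc m)) (+-comm _ _)
    +-homo -[1+ m ] -[1+ n ] = begin
      - (suc (suc (m ℕ.+ n)) × 1#)     ≡⟨ ≡.cong (λ k → - (suc k × 1#)) (≡.sym (ℕ.+-suc m n)) ⟩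
      - ((suc m ℕ.+ suc n) × 1#)       ≈⟨ -‿cong (×-homo-+ 1# (suc m) (suc n)) ⟩
      - (suc m × 1# + suc n × 1#)      ≈⟨ -‿+-comm _ _ ⟨
      - (suc m × 1#) + - (suc n × 1#)  ∎

    -‿homo : ∀ i → ⟦ ℤ.- i ⟧ ≈ - ⟦ i ⟧
    -‿homo (+ zero)  = sym -0#≈0#
    -‿homo (+ suc n) = refl
    -‿homo -[1+ n ]  = sym (-‿involutive _)

    *-homo-pos : ∀ m j → ⟦ + m ℤ.* j ⟧ ≈ ⟦ + m ⟧ * ⟦ j ⟧
    *-homo-pos m (+ n) = begin
      ⟦ + m ℤ.* + n ⟧      ≡⟨ ≡.cong ⟦_⟧ (ℤ.pos-* m n) ⟨
      (m ℕ.* n) × 1#       ≈⟨ ×1-homo-* m n ⟩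
      (m × 1#) * (n × 1#)  ∎
    *-homo-pos m -[1+ n ] = begin
      ⟦ + m ℤ.* -[1+ n ] ⟧         ≡⟨ ≡.cong ⟦_⟧ (ℤ.*-comm (+ m) -[1+ n ]) ⟩
      ⟦ ℤ.- (+ suc n) ℤ.* + m ⟧    ≡⟨ ≡.cong ⟦_⟧ (≡.sym (ℤ.neg-distribˡ-* (+ suc n) (+ m))) ⟩
      ⟦ ℤ.- (+ suc n ℤ.* + m) ⟧    ≈⟨ -‿homo (+ suc n ℤ.* + m) ⟩
      - ⟦ + suc n ℤ.* + m ⟧        ≈⟨ -‿cong (*-homo-pos (suc n) (+ m)) ⟩
      - (suc n × 1# * (m × 1#))    ≈⟨ -‿distribˡ-* _ _ ⟩
      - (suc n × 1#) * (m × 1#)    ≈⟨ *-comm _ _ ⟩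
      m × 1# * - (suc n × 1#)      ∎

    *-homo : ∀ i j → ⟦ i ℤ.* j ⟧ ≈ ⟦ i ⟧ * ⟦ j ⟧
    *-homo (+ m)    j = *-homo-pos m j
    *-homo -[1+ m ] j = begin
      ⟦ ℤ.- (+ suc m) ℤ.* j ⟧    ≡⟨ ≡.cong ⟦_⟧ (≡.sym (ℤ.neg-distribˡ-* (+ suc m) j)) ⟩
      ⟦ ℤ.- (+ suc m ℤ.* j) ⟧    ≈⟨ -‿homo (+ suc m ℤ.* j) ⟩
      - ⟦ + suc m ℤ.* j ⟧        ≈⟨ -‿cong (*-homo-pos (suc m) j) ⟩
      - (suc m × 1# * ⟦ j ⟧)     ≈⟨ -‿distribˡ-* _ _ ⟩
      - (suc m × 1#) * ⟦ j ⟧     ∎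

    homomorphism : ℤ.+-*-rawRing ACR.-Raw-AlmostCommutative⟶ ACR.fromCommutativeRing R
    homomorphism = record
      { ⟦_⟧ = ⟦_⟧ ; +-homo = +-homo ; *-homo = *-homo
      ; -‿homo = -‿homo ; 0-homo = refl ; 1-homo = refl }

    _coeff≟_ : ∀ i j → Maybe (⟦ i ⟧ ≈ ⟦ j ⟧)
    i coeff≟ j = Maybe.map (λ i≡j → reflexive (≡.cong ⟦_⟧ i≡j)) (dec⇒maybe (i ℤ.≟ j))

  open Algebra.Solver.Ring ℤ.+-*-rawRing (ACR.fromCommutativeRing R) homomorphism _coeff≟_ public
    using (solve; _:+_; _:*_; :-_; _:=_; con)

-- Prime divisors of binomial coefficients

∤-! : ∀ {p} → Prime p → ∀ k → k ℕ.< p → ¬ p ℕ.∣ k ℕ.!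
∤-! {suc (suc p)} pr zero    k<p p∣1 = contradiction (ℕ.∣⇒≤ p∣1) λ { (s≤s ()) }
∤-! {p} pr (suc k) k<p p∣k! with euclidsLemma (suc k) (k ℕ.!) pr p∣k!
... | inj₁ p∣1+k = contradiction (ℕ.∣⇒≤ p∣1+k) (ℕ.<⇒≱ k<p)
... | inj₂ p∣k!′ = ∤-! pr k (ℕ.<-trans (ℕ.n<1+n k) k<p) p∣k!′

-- In C(p,k) · k! · (p-k)! = p! the prime divides the right side but neither factorial on the left,
-- since k and p - k are both below p.
prime∣C : ∀ {p} → Prime p → ∀ k → 0 ℕ.< k → k ℕ.< p → p ℕ.∣ p ℕ.C k
prime∣C {suc p} pr k 0<k k<p
  with euclidsLemma (suc p ℕ.C k) (k ℕ.! ℕ.* (suc p ℕ.∸ k) ℕ.!) pr p∣C*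
  where
  instance _ = k ℕ.!* (suc p ℕ.∸ k) !≢0
  C*≡! : (suc p ℕ.C k) ℕ.* (k ℕ.! ℕ.* (suc p ℕ.∸ k) ℕ.!) ≡ suc p ℕ.!
  C*≡! = ≡.trans (≡.cong (ℕ._* (k ℕ.! ℕ.* (suc p ℕ.∸ k) ℕ.!)) (ℕ.nCk≡n!/k![n-k]! (ℕ.<⇒≤ k<p)))
                 (ℕ.m/n*n≡m (ℕ.k![n∸k]!∣n! (ℕ.<⇒≤ k<p)))
  p∣C* : suc p ℕ.∣ (suc p ℕ.C k) ℕ.* (k ℕ.! ℕ.* (suc p ℕ.∸ k) ℕ.!)
  p∣C* = ≡.subst (suc p ℕ.∣_) (≡.sym C*≡!) (ℕ.m∣m*n (p ℕ.!))
... | inj₁ p∣C = p∣C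
... | inj₂ p∣!! with euclidsLemma (k ℕ.!) _ pr p∣!!
... | inj₁ p∣k! = contradiction p∣k! (∤-! pr k k<p)
... | inj₂ p∣! = contradiction p∣! (∤-! pr _ (ℕ.∸-monoʳ-< 0<k (ℕ.<⇒≤ k<p)))

-- Identities in commutative rings: geometric sums, p-th powers, division by 1 - x

module _ (R : CommutativeRing 0ℓ 0ℓ) where
  open CommutativeRing R hiding (zero)
  open import Data.Integer using (+_)
  open import Algebra.Properties.Semiring.Mult semiring
  open import Algebra.Properties.CommutativeMonoid.Mult +-commutativeMonoid using (×-distrib-+)
  open import Algebra.Properties.Semiring.Exp semiring
  open import Algebra.Properties.Semiring.Sum semiring using (sum; sum-init-last)
  open import Algebra.Properties.CommutativeSemiring.Binomial commutativeSemiring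
    using (binomialTerm; theorem)
  open import Relation.Binary.Reasoning.Setoid setoid
  open IntegerCoefficientSolver R

  -- g k stands for 1 + x + … + x^(k-1); it is abstract so that the list of k ones can be used.
  geometric-* : ∀ {x s} (g : ℕ → Carrier) → g 0 ≈ 0# → (∀ k → g (suc k) ≈ 1# + x * g k) →
                x * s ≈ s → ∀ k → g k * s ≈ k × s
  geometric-* {x} {s} g g0 gs xs zero = trans (*-congʳ g0) (zeroˡ s)
  geometric-* {x} {s} g g0 gs xs (suc k) = begin
    g (suc k) * s        ≈⟨ *-congʳ (gs k) ⟩
    (1# + x * g k) * s   ≈⟨ solve 3 (λ x g s → (con (+ 1) :+ x :* g) :* s := s :+ g :* (x :* s)) refl x (g k) s ⟩
    s + g k * (x * s)    ≈⟨ +-congˡ (*-congˡ xs) ⟩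
    s + g k * s          ≈⟨ +-congˡ (geometric-* g g0 gs xs k) ⟩
    s + k × s            ∎

  -- With `g k` the list of k ones this yields (1 - X)Φ = 1 - X^p, hence X^p = 1 modulo Φ.
  geometric-1- : ∀ {x} (g : ℕ → Carrier) → g 0 ≈ 0# → (∀ k → g (suc k) ≈ 1# + x * g k) →
                 ∀ k → (1# + - x) * g k ≈ 1# + - (x ^ k)
  geometric-1- {x} g g0 gs zero = begin
    (1# + - x) * g 0  ≈⟨ *-congˡ g0 ⟩
    (1# + - x) * 0#   ≈⟨ zeroʳ _ ⟩
    0#                ≈⟨ -‿inverseʳ 1# ⟨
    1# + - 1#         ∎
  geometric-1- {x} g g0 gs (suc k) = begin
    (1# + - x) * g (suc k)              ≈⟨ *-congˡ (gs k) ⟩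
    (1# + - x) * (1# + x * g k)         ≈⟨ solve 2 (λ x g → (con (+ 1) :+ :- x) :* (con (+ 1) :+ x :* g)
                                             := con (+ 1) :+ :- x :+ x :* ((con (+ 1) :+ :- x) :* g)) refl x (g k) ⟩
    1# + - x + x * ((1# + - x) * g k)   ≈⟨ +-congˡ (*-congˡ (geometric-1- g g0 gs k)) ⟩
    1# + - x + x * (1# + - (x ^ k))     ≈⟨ solve 2 (λ x y → con (+ 1) :+ :- x :+ x :* (con (+ 1) :+ :- y)
                                             := con (+ 1) :+ :- (x :* y)) refl x (x ^ k) ⟩
    1# + - (x * x ^ k)                  ∎

  _∣×_ : ℕ → Carrier → Set
  m ∣× z = ∃[ w ] z ≈ m × w

  ∣×-sum : ∀ {m n} (t : Fin n → Carrier) → (∀ i → m ∣× t i) → m ∣× sum t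
  ∣×-sum {m} {zero} t h = 0# , sym (×-zeroʳ m)
    where
    ×-zeroʳ : ∀ k → k × 0# ≈ 0#
    ×-zeroʳ zero    = refl
    ×-zeroʳ (suc k) = trans (+-identityˡ _) (×-zeroʳ k)
  ∣×-sum {m} {suc n} t h with h zero | ∣×-sum {m} (t ∘ suc) (h ∘ suc)
  ... | w , e | w′ , e′ = w + w′ , trans (+-cong e e′) (sym (×-distrib-+ w w′ m))

  private
    middleTerm : ∀ {p} → Prime p → ∀ x y k → 0 ℕ.< toℕ k → toℕ k ℕ.< p → p ∣× binomialTerm x y p k
    middleTerm {p} pr x y k 0<k k<p with prime∣C pr (toℕ k) 0<k k<p
    ... | ℕ.divides m e = m × z , (begin
      (p ℕ.C toℕ k) × z   ≡⟨ ≡.cong (_× z) (≡.trans e (ℕ.*-comm m p)) ⟩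
      (p ℕ.* m) × z     ≈⟨ ×-assocˡ z p m ⟨
      p × (m × z)       ∎)
      where z = x ^ toℕ k * y ^ (p ℕ.∸ toℕ k)

  -- All binomial coefficients strictly between the ends are multiples of p. Any commutative ring is
  -- allowed because the result serves twice: as additivity of Frobenius in F and as a congruence
  -- modulo p in Z[X].
  freshman : ∀ {p} → Prime p → ∀ x y → p ∣× ((x + y) ^ p + - (x ^ p + y ^ p))
  freshman {zero} pr = contradiction pr ¬prime[0]
  freshman {suc p} pr x y with ∣×-sum {suc p} mid mid∣
    where
    mid : Fin p → Carrier
    mid i = binomialTerm x y (suc p) (suc (inject₁ i))
    mid∣ : ∀ i → suc p ∣× mid i
    mid∣ i = middleTerm pr x y (suc (inject₁ i)) (s≤s z≤n)
      (s≤s (≡.subst (ℕ._< p) (≡.sym (Fin.toℕ-inject₁ i)) (Fin.toℕ<n i)))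
  ... | w , e = w , (begin
    (x + y) ^ suc p + - (x ^ suc p + y ^ suc p)
      ≈⟨ +-congʳ (theorem (suc p) x y) ⟩
    sum (binomialTerm x y (suc p)) + - (x ^ suc p + y ^ suc p)
      ≈⟨ +-congʳ (+-cong first (trans (sum-init-last {p} (binomialTerm x y (suc p) ∘ suc)) (+-cong e last))) ⟩
    (y ^ suc p + (suc p × w + x ^ suc p)) + - (x ^ suc p + y ^ suc p)
      ≈⟨ solve 3 (λ a b c → (b :+ (c :+ a)) :+ :- (a :+ b) := c) refl (x ^ suc p) (y ^ suc p) (suc p × w) ⟩
    suc p × w  ∎)
    where
    first : binomialTerm x y (suc p) zero ≈ y ^ suc p
    first = begin
      (suc p ℕ.C 0) × (1# * y ^ suc p)  ≡⟨ ≡.cong (_× (1# * y ^ suc p)) (≡.trans (ℕ.nCk≡nC[n∸k] {0} {suc p} z≤n) (ℕ.nCn≡1 (suc p))) ⟩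
      1 × (1# * y ^ suc p)            ≈⟨ ×-homo-1 _ ⟩
      1# * y ^ suc p                  ≈⟨ *-identityˡ _ ⟩
      y ^ suc p                       ∎
    last : binomialTerm x y (suc p) (suc (fromℕ p)) ≈ x ^ suc p
    last = term (Fin.toℕ-fromℕ p)
      where
      term : ∀ {k} → k ≡ p → (suc p ℕ.C suc k) × (x ^ suc k * y ^ (p ℕ.∸ k)) ≈ x ^ suc p
      term ≡.refl = begin
        (suc p ℕ.C suc p) × (x ^ suc p * y ^ (p ℕ.∸ p))
          ≡⟨ ≡.cong₂ (λ c e → c × (x ^ suc p * y ^ e)) (ℕ.nCn≡1 (suc p)) (ℕ.n∸n≡0 p) ⟩
        1 × (x ^ suc p * 1#)  ≈⟨ ×-homo-1 _ ⟩
        x ^ suc p * 1#        ≈⟨ *-identityʳ _ ⟩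
        x ^ suc p             ∎

  1-[1-x]g : ∀ {x y g} → (1# + - x) * g ≈ 1# + - y → y ≈ 1# + g * - (1# + - x)
  1-[1-x]g {x} {y} {g} e = begin
    y                           ≈⟨ solve 1 (λ y → y := con (+ 1) :+ :- (con (+ 1) :+ :- y)) refl y ⟩
    1# + - (1# + - y)           ≈⟨ +-congˡ (-‿cong e) ⟨
    1# + - ((1# + - x) * g)     ≈⟨ solve 2 (λ x g → con (+ 1) :+ :- ((con (+ 1) :+ :- x) :* g)
                                     := con (+ 1) :+ g :* :- (con (+ 1) :+ :- x)) refl x g ⟩
    1# + g * - (1# + - x)       ∎

  x≈[x-y]+y*1 : ∀ x y → x ≈ (x + - y) + y * 1#
  x≈[x-y]+y*1 = solve 2 (λ x y → x := (x :+ :- y) :+ y :* con (+ 1)) refl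

  1^ : ∀ k → 1# ^ k ≈ 1#
  1^ zero    = refl
  1^ (suc k) = trans (*-identityˡ _) (1^ k)

  private
    y*[a-g] : ∀ y a g → y * (a + - g) ≈ y * a + - (y * g)
    y*[a-g] = solve 3 (λ y a g → y :* (a :+ :- g) := y :* a :+ :- (y :* g)) refl

    a-[1-b] : ∀ a b → a + - (1# + - b) ≈ - 1# * (1# + - (a + b))
    a-[1-b] = solve 2 (λ a b → a :+ :- (con (+ 1) :+ :- b) := :- con (+ 1) :* (con (+ 1) :+ :- (a :+ b))) refl

    1-x+x : ∀ x → 1# + - x + x ≈ 1#
    1-x+x = solve 1 (λ x → con (+ 1) :+ :- x :+ x := con (+ 1)) refl

  -- Modulo p, 1 = ((1 - x) + x)^p = (1 - x)^p + x^p, so (1 - x)^p agrees with 1 - x^p = (1 - x)g.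
  -- The common factor 1 - x is removed later, in Z[X], where its constant term 1 permits it.
  [1-x]*[[1-x]^m-g] : ∀ {m} → Prime (suc m) → ∀ {x g} → (1# + - x) * g ≈ 1# + - (x ^ suc m) →
                      suc m ∣× ((1# + - x) * ((1# + - x) ^ m + - g))
  [1-x]*[[1-x]^m-g] {m} pr {x} {g} e = - 1# * w , [1-x]*≈
    where
    y = 1# + - x
    w = proj₁ (freshman pr y x)
    1≈ : 1# ≈ (y + x) ^ suc m
    1≈ = sym (trans (^-congˡ (suc m) (1-x+x x)) (1^ (suc m)))
    [1-x]*≈ : y * (y ^ m + - g) ≈ suc m × (- 1# * w)
    [1-x]*≈ = begin
      y * (y ^ m + - g)                                      ≈⟨ y*[a-g] y (y ^ m) g ⟩
      y ^ suc m + - (y * g)                                  ≈⟨ +-congˡ (-‿cong e) ⟩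
      y ^ suc m + - (1# + - (x ^ suc m))                     ≈⟨ a-[1-b] (y ^ suc m) (x ^ suc m) ⟩
      - 1# * (1# + - (y ^ suc m + x ^ suc m))                ≈⟨ *-congˡ (+-congʳ 1≈) ⟩
      - 1# * ((y + x) ^ suc m + - (y ^ suc m + x ^ suc m))   ≈⟨ *-congˡ (proj₂ (freshman pr y x)) ⟩
      - 1# * (suc m × w)                                     ≈⟨ ×-comm-* (suc m) (- 1#) w ⟩
      suc m × (- 1# * w)                                     ∎

  -- One Horner step of division by 1 - x: if c is the remainder of f, then a + c is that of a + x
  -- f.
  horner-1-x : ∀ {f f′ a c x} → f ≈ c + (1# + - x) * f′ → a + x * f ≈ (a + c) + (1# + - x) * (- c + x * f′)
  horner-1-x {f} {f′} {a} {c} {x} e = trans (+-congˡ (*-congˡ e)) (rearrange a x c f′)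
    where
    rearrange : ∀ a x c f′ → a + x * (c + (1# + - x) * f′) ≈ (a + c) + (1# + - x) * (- c + x * f′)
    rearrange = solve 4 (λ a x c f → a :+ x :* (c :+ (con (+ 1) :+ :- x) :* f)
      := (a :+ c) :+ (con (+ 1) :+ :- x) :* (:- c :+ x :* f)) refl

  -- Applied to Φ = p + π u, where it turns the vanishing of Φ in Z[ζ] into p = -π u.
  constant-term : ∀ {g c y z} → g ≈ c + y * z → c ≈ y * - z + g * 1#
  constant-term {g} {c} {y} {z} e = trans (rearrange c y z) (+-congˡ (*-congʳ (sym e)))
    where
    rearrange : ∀ c y z → c ≈ y * - z + (c + y * z) * 1#
    rearrange = solve 3 (λ c y z → c := y :* :- z :+ (c :+ y :* z) :* con (+ 1)) refl

  *-cancelˡ-torsionFree : ∀ {y} → (∀ z → y * z ≈ 0# → z ≈ 0#) → ∀ u v → y * u ≈ y * v → u ≈ v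
  *-cancelˡ-torsionFree {y} h u v e = trans (split u v) (trans (+-congʳ (h (u + - v)
    (trans (distrib-- y u v) (trans (+-congʳ e) (-‿inverseʳ _))))) (+-identityˡ v))
    where
    split : ∀ u v → u ≈ (u + - v) + v
    split = solve 2 (λ u v → u := (u :+ :- v) :+ v) refl
    distrib-- : ∀ y u v → y * (u + - v) ≈ y * u + - (y * v)
    distrib-- = solve 3 (λ y u v → y :* (u :+ :- v) := y :* u :+ :- (y :* v)) refl

  ^-periodic : ∀ {x p} → .{{_ : ℕ.NonZero p}} → x ^ p ≈ 1# → ∀ m → x ^ m ≈ x ^ (m ℕ.% p)
  ^-periodic {x} {p} x^p≈1 m = begin
    x ^ m                                     ≡⟨ ≡.cong (x ^_) (ℕ.m≡m%n+[m/n]*n m p) ⟩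
    x ^ (m ℕ.% p ℕ.+ m ℕ./ p ℕ.* p)           ≈⟨ ^-homo-* x (m ℕ.% p) _ ⟩
    x ^ (m ℕ.% p) * x ^ (m ℕ./ p ℕ.* p)       ≡⟨ ≡.cong (λ k → x ^ (m ℕ.% p) * x ^ k) (ℕ.*-comm (m ℕ./ p) p) ⟩
    x ^ (m ℕ.% p) * x ^ (p ℕ.* (m ℕ./ p))     ≈⟨ *-congˡ (^-assocʳ x p (m ℕ./ p)) ⟨
    x ^ (m ℕ.% p) * (x ^ p) ^ (m ℕ./ p)       ≈⟨ *-congˡ (^-congˡ (m ℕ./ p) x^p≈1) ⟩
    x ^ (m ℕ.% p) * 1# ^ (m ℕ./ p)            ≈⟨ *-congˡ (1^ (m ℕ./ p)) ⟩
    x ^ (m ℕ.% p) * 1#                        ≈⟨ *-identityʳ _ ⟩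
    x ^ (m ℕ.% p)                             ∎

-- The quotient of a commutative ring by a principal ideal

module _ (R : CommutativeRing 0ℓ 0ℓ) (m : CommutativeRing.Carrier R) where
  open CommutativeRing R hiding (zero)
  open import Data.Integer using (+_)
  open IntegerCoefficientSolver R

  -- The cofactor is explicit, so that congruence modulo Φ has the shape of the equation in
  -- `PiPowDivides`.
  record CongruentMod (x y : Carrier) : Set where
    constructor mod
    field
      quotient : Carrier
      equality : x ≈ y + m * quotient

  private
    _~_ = CongruentMod
    infix 4 _~_

  ≈⇒~ : ∀ {x y} → x ≈ y → x ~ y
  ≈⇒~ {x} {y} x≈y = mod 0# (trans x≈y (solve 2 (λ y m → y := y :+ m :* con (+ 0)) refl y m))

  quotientRing : CommutativeRing 0ℓ 0ℓ
  quotientRing = record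
    { Carrier = Carrier ; _≈_ = _~_ ; _+_ = _+_ ; _*_ = _*_ ; -_ = -_ ; 0# = 0# ; 1# = 1#
    ; isCommutativeRing = record
      { isRing = record
        { +-isAbelianGroup = record
          { isGroup = record
            { isMonoid = record
              { isSemigroup = record
                { isMagma = record
                  { isEquivalence = record { refl = ≈⇒~ refl ; sym = ~-sym ; trans = ~-trans }
                  ; ∙-cong = ~-+-cong }
                ; assoc = λ x y z → ≈⇒~ (+-assoc x y z) }
              ; identity = (λ x → ≈⇒~ (+-identityˡ x)) , (λ x → ≈⇒~ (+-identityʳ x)) }
            ; inverse = (λ x → ≈⇒~ (-‿inverseˡ x)) , (λ x → ≈⇒~ (-‿inverseʳ x))
            ; ⁻¹-cong = ~--cong }
          ; comm = λ x y → ≈⇒~ (+-comm x y) }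
        ; *-cong = ~-*-cong
        ; *-assoc = λ x y z → ≈⇒~ (*-assoc x y z)
        ; *-identity = (λ x → ≈⇒~ (*-identityˡ x)) , (λ x → ≈⇒~ (*-identityʳ x))
        ; distrib = (λ x y z → ≈⇒~ (distribˡ x y z)) , (λ x y z → ≈⇒~ (distribʳ x y z)) }
      ; *-comm = λ x y → ≈⇒~ (*-comm x y) } }
    where
    ~-sym : ∀ {x y} → x ~ y → y ~ x
    ~-sym {x} {y} (mod u e) = mod (- u) (trans
      (solve 3 (λ y m u → y := (y :+ m :* u) :+ m :* :- u) refl y m u) (+-congʳ (sym e)))
    ~-trans : ∀ {x y z} → x ~ y → y ~ z → x ~ z
    ~-trans {z = z} (mod u e) (mod v f) = mod (v + u) (trans e (trans (+-congʳ f)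
      (solve 4 (λ z m u v → (z :+ m :* v) :+ m :* u := z :+ m :* (v :+ u)) refl z m u v)))
    ~-+-cong : ∀ {x y z w} → x ~ y → z ~ w → x + z ~ y + w
    ~-+-cong {y = y} {w = w} (mod u e) (mod v f) = mod (u + v) (trans (+-cong e f)
      (solve 5 (λ y w m u v → (y :+ m :* u) :+ (w :+ m :* v) := (y :+ w) :+ m :* (u :+ v)) refl y w m u v))
    ~--cong : ∀ {x y} → x ~ y → - x ~ - y
    ~--cong {y = y} (mod u e) = mod (- u) (trans (-‿cong e)
      (solve 3 (λ y m u → :- (y :+ m :* u) := :- y :+ m :* :- u) refl y m u))
    ~-*-cong : ∀ {x y z w} → x ~ y → z ~ w → x * z ~ y * w
    ~-*-cong {y = y} {w = w} (mod u e) (mod v f) = mod (u * w + (y * v + u * (m * v))) (trans (*-cong e f)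
      (solve 5 (λ y w m u v → (y :+ m :* u) :* (w :+ m :* v)
        := y :* w :+ m :* (u :* w :+ (y :* v :+ u :* (m :* v)))) refl y w m u v))

-- The polynomial ring Z[X] on coefficient lists

module IntegerPolynomials where
  open import Data.Integer using (+_)

  infix 4 _≃_
  -- Comparing coefficients ignores trailing zeros, so that lists form a ring. The record keeps f
  -- and g visible to unification, unlike the bare family `f ≋ g` of coefficient equations.
  record _≃_ (f g : Poly) : Set where
    constructor mk
    field at : f ≋ g
  open _≃_ public

  ≃-refl : ∀ {f} → f ≃ f
  ≃-refl = mk λ i → ≡.refl

  ≃-sym : ∀ {f g} → f ≃ g → g ≃ f
  ≃-sym (mk e) = mk λ i → ≡.sym (e i)

  ≃-trans : ∀ {f g h} → f ≃ g → g ≃ h → f ≃ h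
  ≃-trans (mk e) (mk e′) = mk λ i → ≡.trans (e i) (e′ i)

  ∷-cong : ∀ {a b f g} → a ≡ b → f ≃ g → a ∷ f ≃ b ∷ g
  ∷-cong a≡b (mk e) = mk λ { zero → a≡b ; (suc i) → e i }

  0∷[] : + 0 ∷ [] ≃ []
  0∷[] = mk λ { zero → ≡.refl ; (suc i) → ≡.refl }

  pneg : Poly → Poly
  pneg = map (ℤ.-_)

  scale : ℤ → Poly → Poly
  scale a = map (a ℤ.*_)

  coeff-padd : ∀ f g i → coeff (padd f g) i ≡ coeff f i ℤ.+ coeff g i
  coeff-padd []      g       i       = ≡.sym (ℤ.+-identityˡ _)
  coeff-padd (a ∷ f) []      i       = ≡.sym (ℤ.+-identityʳ _)
  coeff-padd (a ∷ f) (b ∷ g) zero    = ≡.refl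
  coeff-padd (a ∷ f) (b ∷ g) (suc i) = coeff-padd f g i

  coeff-scale : ∀ a f i → coeff (scale a f) i ≡ a ℤ.* coeff f i
  coeff-scale a []      i       = ≡.sym (ℤ.*-zeroʳ a)
  coeff-scale a (b ∷ f) zero    = ≡.refl
  coeff-scale a (b ∷ f) (suc i) = coeff-scale a f i

  coeff-pneg : ∀ f i → coeff (pneg f) i ≡ ℤ.- coeff f i
  coeff-pneg []      i       = ≡.refl
  coeff-pneg (b ∷ f) zero    = ≡.refl
  coeff-pneg (b ∷ f) (suc i) = coeff-pneg f i

  padd-cong : ∀ {f f′ g g′} → f ≃ f′ → g ≃ g′ → padd f g ≃ padd f′ g′
  padd-cong {f} {f′} {g} {g′} (mk e) (mk e′) = mk λ i →
    ≡.trans (coeff-padd f g i) (≡.trans (≡.cong₂ ℤ._+_ (e i) (e′ i)) (≡.sym (coeff-padd f′ g′ i)))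

  padd-comm : ∀ f g → padd f g ≃ padd g f
  padd-comm f g = mk λ i →
    ≡.trans (coeff-padd f g i) (≡.trans (ℤ.+-comm (coeff f i) (coeff g i)) (≡.sym (coeff-padd g f i)))

  padd-assoc : ∀ f g h → padd (padd f g) h ≃ padd f (padd g h)
  padd-assoc f g h = mk λ i → begin
    coeff (padd (padd f g) h) i                  ≡⟨ coeff-padd (padd f g) h i ⟩
    coeff (padd f g) i ℤ.+ coeff h i             ≡⟨ ≡.cong (ℤ._+ coeff h i) (coeff-padd f g i) ⟩
    coeff f i ℤ.+ coeff g i ℤ.+ coeff h i        ≡⟨ ℤ.+-assoc (coeff f i) (coeff g i) (coeff h i) ⟩
    coeff f i ℤ.+ (coeff g i ℤ.+ coeff h i)      ≡⟨ ≡.cong (λ z → coeff f i ℤ.+ z) (≡.sym (coeff-padd g h i)) ⟩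
    coeff f i ℤ.+ coeff (padd g h) i             ≡⟨ ≡.sym (coeff-padd f (padd g h) i) ⟩
    coeff (padd f (padd g h)) i                  ∎
    where open ≡.≡-Reasoning

  padd-identityʳ : ∀ f → padd f [] ≃ f
  padd-identityʳ []      = ≃-refl
  padd-identityʳ (a ∷ f) = ≃-refl

  padd-inverseˡ : ∀ f → padd (pneg f) f ≃ []
  padd-inverseˡ f = mk λ i → ≡.trans (coeff-padd (pneg f) f i)
    (≡.trans (≡.cong (ℤ._+ coeff f i) (coeff-pneg f i)) (ℤ.+-inverseˡ (coeff f i)))

  pneg-cong : ∀ {f g} → f ≃ g → pneg f ≃ pneg g
  pneg-cong {f} {g} (mk e) = mk λ i →
    ≡.trans (coeff-pneg f i) (≡.trans (≡.cong ℤ.-_ (e i)) (≡.sym (coeff-pneg g i)))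

  padd-abelianGroup : AbelianGroup 0ℓ 0ℓ
  padd-abelianGroup = record
    { Carrier = Poly ; _≈_ = _≃_ ; _∙_ = padd ; ε = [] ; _⁻¹ = pneg
    ; isAbelianGroup = record
      { isGroup = record
        { isMonoid = record
          { isSemigroup = record
            { isMagma = record
              { isEquivalence = record { refl = ≃-refl ; sym = ≃-sym ; trans = ≃-trans }
              ; ∙-cong = padd-cong }
            ; assoc = padd-assoc }
          ; identity = (λ f → ≃-refl) , padd-identityʳ }
        ; inverse = padd-inverseˡ , (λ f → ≃-trans (padd-comm f (pneg f)) (padd-inverseˡ f))
        ; ⁻¹-cong = pneg-cong }
      ; comm = padd-comm } }

  open AbelianGroup padd-abelianGroup using (setoid; commutativeSemigroup)
  open Algebra.Properties.CommutativeSemigroup commutativeSemigroup using (interchange; x∙yz≈y∙xz)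
  module ≃-Reasoning = Relation.Binary.Reasoning.Setoid setoid

  scale-cong : ∀ a {f g} → f ≃ g → scale a f ≃ scale a g
  scale-cong a {f} {g} (mk e) = mk λ i →
    ≡.trans (coeff-scale a f i) (≡.trans (≡.cong (a ℤ.*_) (e i)) (≡.sym (coeff-scale a g i)))

  scale-padd : ∀ a f g → scale a (padd f g) ≃ padd (scale a f) (scale a g)
  scale-padd a f g = mk λ i → let open ≡.≡-Reasoning in begin
    coeff (scale a (padd f g)) i                    ≡⟨ coeff-scale a (padd f g) i ⟩
    a ℤ.* coeff (padd f g) i                        ≡⟨ ≡.cong (a ℤ.*_) (coeff-padd f g i) ⟩
    a ℤ.* (coeff f i ℤ.+ coeff g i)                 ≡⟨ ℤ.*-distribˡ-+ a (coeff f i) (coeff g i) ⟩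
    a ℤ.* coeff f i ℤ.+ a ℤ.* coeff g i             ≡⟨ ≡.cong₂ ℤ._+_ (≡.sym (coeff-scale a f i)) (≡.sym (coeff-scale a g i)) ⟩
    coeff (scale a f) i ℤ.+ coeff (scale a g) i     ≡⟨ ≡.sym (coeff-padd (scale a f) (scale a g) i) ⟩
    coeff (padd (scale a f) (scale a g)) i          ∎

  scale-scale : ∀ a b f → scale a (scale b f) ≃ scale (a ℤ.* b) f
  scale-scale a b f = mk λ i →
    ≡.trans (coeff-scale a (scale b f) i) (≡.trans (≡.cong (a ℤ.*_) (coeff-scale b f i))
    (≡.trans (≡.sym (ℤ.*-assoc a b (coeff f i))) (≡.sym (coeff-scale (a ℤ.* b) f i))))

  scale-0 : ∀ f → scale (+ 0) f ≃ []
  scale-0 f = mk λ i → ≡.trans (coeff-scale (+ 0) f i) (ℤ.*-zeroˡ (coeff f i))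

  scale-1 : ∀ f → scale (+ 1) f ≃ f
  scale-1 f = mk λ i → ≡.trans (coeff-scale (+ 1) f i) (ℤ.*-identityˡ (coeff f i))

  pmul-congˡ : ∀ f {g g′} → g ≃ g′ → pmul f g ≃ pmul f g′
  pmul-congˡ []      e = ≃-refl
  pmul-congˡ (a ∷ f) e = padd-cong (scale-cong a e) (∷-cong ≡.refl (pmul-congˡ f e))

  pmul-zeroʳ : ∀ f → pmul f [] ≃ []
  pmul-zeroʳ []      = ≃-refl
  pmul-zeroʳ (a ∷ f) = ≃-trans (∷-cong ≡.refl (pmul-zeroʳ f)) 0∷[]

  -- `pmul` recurses on its left factor; with this mirror recursion on the right factor,
  -- commutativity becomes a plain induction.
  pmul-∷ʳ : ∀ f b g → pmul f (b ∷ g) ≃ padd (scale b f) (+ 0 ∷ pmul f g)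
  pmul-∷ʳ []      b g = ≃-sym 0∷[]
  pmul-∷ʳ (a ∷ f) b g = ∷-cong (≡.cong (ℤ._+ + 0) (ℤ.*-comm a b)) (let open ≃-Reasoning in begin
    padd (scale a g) (pmul f (b ∷ g))                       ≈⟨ padd-cong (≃-refl {scale a g}) (pmul-∷ʳ f b g) ⟩
    padd (scale a g) (padd (scale b f) (+ 0 ∷ pmul f g))    ≈⟨ x∙yz≈y∙xz (scale a g) (scale b f) _ ⟩
    padd (scale b f) (padd (scale a g) (+ 0 ∷ pmul f g))    ∎)

  pmul-comm : ∀ f g → pmul f g ≃ pmul g f
  pmul-comm []      g = ≃-sym (pmul-zeroʳ g)
  pmul-comm (a ∷ f) g = ≃-trans
    (padd-cong (≃-refl {scale a g}) (∷-cong ≡.refl (pmul-comm f g))) (≃-sym (pmul-∷ʳ g a f))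

  pmul-congʳ : ∀ {f f′} g → f ≃ f′ → pmul f g ≃ pmul f′ g
  pmul-congʳ {f} {f′} g e = ≃-trans (pmul-comm f g) (≃-trans (pmul-congˡ g e) (pmul-comm g f′))

  pmul-distribˡ : ∀ f g h → pmul f (padd g h) ≃ padd (pmul f g) (pmul f h)
  pmul-distribˡ []      g h = ≃-refl
  pmul-distribˡ (a ∷ f) g h = let open ≃-Reasoning in begin
    padd (scale a (padd g h)) (+ 0 ∷ pmul f (padd g h))
      ≈⟨ padd-cong (scale-padd a g h) (∷-cong ≡.refl (pmul-distribˡ f g h)) ⟩
    padd (padd (scale a g) (scale a h)) (padd (+ 0 ∷ pmul f g) (+ 0 ∷ pmul f h))
      ≈⟨ interchange (scale a g) (scale a h) _ _ ⟩
    padd (pmul (a ∷ f) g) (pmul (a ∷ f) h) ∎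

  pmul-distribʳ : ∀ f g h → pmul (padd g h) f ≃ padd (pmul g f) (pmul h f)
  pmul-distribʳ f g h = let open ≃-Reasoning in begin
    pmul (padd g h) f            ≈⟨ pmul-comm (padd g h) f ⟩
    pmul f (padd g h)            ≈⟨ pmul-distribˡ f g h ⟩
    padd (pmul f g) (pmul f h)   ≈⟨ padd-cong (pmul-comm f g) (pmul-comm f h) ⟩
    padd (pmul g f) (pmul h f)   ∎

  pmul-scale : ∀ a f g → pmul (scale a f) g ≃ scale a (pmul f g)
  pmul-scale a []      g = ≃-refl
  pmul-scale a (b ∷ f) g = let open ≃-Reasoning in begin
    padd (scale (a ℤ.* b) g) (+ 0 ∷ pmul (scale a f) g)
      ≈⟨ padd-cong (≃-sym (scale-scale a b g)) (∷-cong (≡.sym (ℤ.*-zeroʳ a)) (pmul-scale a f g)) ⟩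
    padd (scale a (scale b g)) (scale a (+ 0 ∷ pmul f g))
      ≈⟨ scale-padd a (scale b g) (+ 0 ∷ pmul f g) ⟨
    scale a (pmul (b ∷ f) g) ∎

  pmul-shift : ∀ f g → pmul (+ 0 ∷ f) g ≃ + 0 ∷ pmul f g
  pmul-shift f g = padd-cong (scale-0 g) (≃-refl {+ 0 ∷ pmul f g})

  pmul-assoc : ∀ f g h → pmul (pmul f g) h ≃ pmul f (pmul g h)
  pmul-assoc []      g h = ≃-refl
  pmul-assoc (a ∷ f) g h = let open ≃-Reasoning in begin
    pmul (padd (scale a g) (+ 0 ∷ pmul f g)) h
      ≈⟨ pmul-distribʳ h (scale a g) (+ 0 ∷ pmul f g) ⟩
    padd (pmul (scale a g) h) (pmul (+ 0 ∷ pmul f g) h)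
      ≈⟨ padd-cong (pmul-scale a g h) (pmul-shift (pmul f g) h) ⟩
    padd (scale a (pmul g h)) (+ 0 ∷ pmul (pmul f g) h)
      ≈⟨ padd-cong (≃-refl {scale a (pmul g h)}) (∷-cong ≡.refl (pmul-assoc f g h)) ⟩
    pmul (a ∷ f) (pmul g h) ∎

  pmul-identityˡ : ∀ f → pmul (+ 1 ∷ []) f ≃ f
  pmul-identityˡ f = let open ≃-Reasoning in begin
    padd (scale (+ 1) f) (+ 0 ∷ [])  ≈⟨ padd-cong (scale-1 f) 0∷[] ⟩
    padd f []                        ≈⟨ padd-identityʳ f ⟩
    f                                ∎

  ℤ[X] : CommutativeRing 0ℓ 0ℓ
  ℤ[X] = record
    { Carrier = Poly ; _≈_ = _≃_ ; _+_ = padd ; _*_ = pmul ; -_ = pneg ; 0# = [] ; 1# = + 1 ∷ []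
    ; isCommutativeRing = record
      { isRing = record
        { +-isAbelianGroup = AbelianGroup.isAbelianGroup padd-abelianGroup
        ; *-cong = λ {f} {f′} {g} {g′} e e′ → ≃-trans (pmul-congʳ g e) (pmul-congˡ f′ e′)
        ; *-assoc = pmul-assoc
        ; *-identity = pmul-identityˡ , (λ f → ≃-trans (pmul-comm f _) (pmul-identityˡ f))
        ; distrib = pmul-distribˡ , pmul-distribʳ }
      ; *-comm = pmul-comm } }

  -- Evaluation at X = 1. It sends π to 0 and Φ to p, so it induces the residue map from Z[ζ] to Z/p
  -- at π.
  eval₁ : Poly → ℤ
  eval₁ []      = + 0
  eval₁ (a ∷ f) = a ℤ.+ eval₁ f

  eval₁-zero : ∀ f → f ≃ [] → eval₁ f ≡ + 0
  eval₁-zero []      e = ≡.refl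
  eval₁-zero (a ∷ f) e = ≡.cong₂ ℤ._+_ (at e 0) (eval₁-zero f (mk λ i → at e (suc i)))

  eval₁-cong : ∀ {f g} → f ≃ g → eval₁ f ≡ eval₁ g
  eval₁-cong {[]}    {g}     e = ≡.sym (eval₁-zero g (≃-sym e))
  eval₁-cong {a ∷ f} {[]}    e = eval₁-zero (a ∷ f) e
  eval₁-cong {a ∷ f} {b ∷ g} e = ≡.cong₂ ℤ._+_ (at e 0) (eval₁-cong {f} {g} (mk λ i → at e (suc i)))

  eval₁-padd : ∀ f g → eval₁ (padd f g) ≡ eval₁ f ℤ.+ eval₁ g
  eval₁-padd []      g       = ≡.sym (ℤ.+-identityˡ _)
  eval₁-padd (a ∷ f) []      = ≡.sym (ℤ.+-identityʳ _)
  eval₁-padd (a ∷ f) (b ∷ g) = ≡.trans (≡.cong (λ z → a ℤ.+ b ℤ.+ z) (eval₁-padd f g))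
    (Algebra.Properties.CommutativeSemigroup.interchange ℤ.+-commutativeSemigroup a b (eval₁ f) (eval₁ g))

  eval₁-scale : ∀ a f → eval₁ (scale a f) ≡ a ℤ.* eval₁ f
  eval₁-scale a []      = ≡.sym (ℤ.*-zeroʳ a)
  eval₁-scale a (b ∷ f) = ≡.trans (≡.cong (λ z → a ℤ.* b ℤ.+ z) (eval₁-scale a f)) (≡.sym (ℤ.*-distribˡ-+ a b (eval₁ f)))

  eval₁-pmul : ∀ f g → eval₁ (pmul f g) ≡ eval₁ f ℤ.* eval₁ g
  eval₁-pmul []      g = ≡.refl
  eval₁-pmul (a ∷ f) g = let open ≡.≡-Reasoning in begin
    eval₁ (padd (scale a g) (+ 0 ∷ pmul f g))          ≡⟨ eval₁-padd (scale a g) (+ 0 ∷ pmul f g) ⟩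
    eval₁ (scale a g) ℤ.+ (+ 0 ℤ.+ eval₁ (pmul f g))   ≡⟨ ≡.cong₂ ℤ._+_ (eval₁-scale a g) (≡.trans (ℤ.+-identityˡ _) (eval₁-pmul f g)) ⟩
    a ℤ.* eval₁ g ℤ.+ eval₁ f ℤ.* eval₁ g              ≡⟨ ℤ.*-distribʳ-+ (eval₁ g) a (eval₁ f) ⟨
    (a ℤ.+ eval₁ f) ℤ.* eval₁ g                        ∎

  X : Poly
  X = + 0 ∷ + 1 ∷ []

  X-* : ∀ f → pmul X f ≃ + 0 ∷ f
  X-* f = ≃-trans (pmul-shift (+ 1 ∷ []) f) (∷-cong ≡.refl (pmul-identityˡ f))

  open import Algebra.Properties.Semiring.Exp (CommutativeRing.semiring ℤ[X]) using (_^_)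
  open import Algebra.Properties.Semiring.Mult (CommutativeRing.semiring ℤ[X]) using (_×_)

  ppow-^ : ∀ f k → ppow f k ≡ f ^ k
  ppow-^ f zero    = ≡.refl
  ppow-^ f (suc k) = ≡.cong (pmul f) (ppow-^ f k)

  cyclotomic-suc : ∀ k → cyclotomic (suc k) ≃ padd (+ 1 ∷ []) (pmul X (cyclotomic k))
  cyclotomic-suc k = ≃-sym (padd-cong (≃-refl {+ 1 ∷ []}) (X-* (cyclotomic k)))

  coeff-× : ∀ n f i → coeff (n × f) i ≡ + n ℤ.* coeff f i
  coeff-× zero    f i = ≡.sym (ℤ.*-zeroˡ (coeff f i))
  coeff-× (suc n) f i = let open ≡.≡-Reasoning in begin
    coeff (padd f (n × f)) i            ≡⟨ coeff-padd f (n × f) i ⟩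
    coeff f i ℤ.+ coeff (n × f) i       ≡⟨ ≡.cong (λ z → coeff f i ℤ.+ z) (coeff-× n f i) ⟩
    coeff f i ℤ.+ + n ℤ.* coeff f i     ≡⟨ ℤ.suc-* (+ n) (coeff f i) ⟨
    + suc n ℤ.* coeff f i               ∎

  module _ (p : ℕ) where

    Divides : Poly → Set
    Divides f = ∀ i → + p ℤ.∣ coeff f i

    Divides-× : ∀ f → Divides (p × f)
    Divides-× f i = ℤ.divides (coeff f i) (≡.trans (coeff-× p f i) (ℤ.*-comm (+ p) _))

    divide : ∀ f → Divides f → ∃[ g ] f ≃ p × g
    divide []      d = [] , mk λ i → ≡.trans (≡.sym (ℤ.*-zeroʳ (+ p))) (≡.sym (coeff-× p [] i))
    divide (a ∷ f) d with d 0 | divide f (λ i → d (suc i))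
    ... | ℤ.divides b a≡bp | g , f≃pg = b ∷ g , mk λ
      { zero    → ≡.trans a≡bp (≡.trans (ℤ.*-comm b (+ p)) (≡.sym (coeff-× p (b ∷ g) 0)))
      ; (suc i) → ≡.trans (≡.trans (at f≃pg i) (coeff-× p g i)) (≡.sym (coeff-× p (b ∷ g) (suc i))) }

    -- A polynomial with constant term 1 is a unit among power series.
    Divides-cancel : ∀ u f → Divides (pmul (+ 1 ∷ u) f) → Divides f
    Divides-cancel u []      d i = ℤ.divides (+ 0) ≡.refl
    Divides-cancel u (a ∷ f) d   = λ { zero → p∣a ; (suc i) → Divides-cancel u f p∣f i }
      where
      expand : pmul (+ 1 ∷ u) (a ∷ f) ≃ padd (scale a (+ 1 ∷ u)) (+ 0 ∷ pmul (+ 1 ∷ u) f)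
      expand = pmul-∷ʳ (+ 1 ∷ u) a f
      p∣a : + p ℤ.∣ a
      p∣a = ≡.subst (+ p ℤ.∣_)
        (≡.trans (at expand 0) (≡.trans (ℤ.+-identityʳ _) (ℤ.*-identityʳ a))) (d 0)
      p∣f : Divides (pmul (+ 1 ∷ u) f)
      p∣f i = ℤ.∣m+n∣m⇒∣n
        (≡.subst (+ p ℤ.∣_) (≡.trans (at expand (suc i)) (coeff-padd (scale a u) _ i)) (d (suc i)))
        (≡.subst (+ p ℤ.∣_) (≡.sym (coeff-scale a u i)) (ℤ.∣m⇒∣m*n (coeff u i) p∣a))

    ×-cancel : .{{_ : ℕ.NonZero p}} → ∀ f g → p × f ≃ p × g → f ≃ g
    ×-cancel f g e = mk λ i → ℤ.*-cancelˡ-≡ (+ p) (coeff f i) (coeff g i)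
      (≡.trans (≡.sym (coeff-× p f i)) (≡.trans (at e i) (coeff-× p g i)))

    eval₁-× : ∀ f → eval₁ (p × f) ≡ + p ℤ.* eval₁ f
    eval₁-× f = go p
      where
      go : ∀ n → eval₁ (n × f) ≡ + n ℤ.* eval₁ f
      go zero    = ≡.sym (ℤ.*-zeroˡ (eval₁ f))
      go (suc n) = ≡.trans (eval₁-padd f (n × f))
        (≡.trans (≡.cong (λ z → eval₁ f ℤ.+ z) (go n)) (≡.sym (ℤ.suc-* (+ n) (eval₁ f))))

    eval₁-cyclotomic : eval₁ (cyclotomic p) ≡ + p
    eval₁-cyclotomic = go p
      where
      go : ∀ n → eval₁ (cyclotomic n) ≡ + n
      go zero    = ≡.refl
      go (suc n) = ≡.cong (λ z → + 1 ℤ.+ z) (go n)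

-- The ring Z[ζ] and divisibility by π = 1 - ζ

module CyclotomicIntegers (p-1 : ℕ) (pr : Prime (suc p-1)) where
  open IntegerPolynomials
  open import Data.Integer using (+_; -[1+_])
  private
    p : ℕ
    p = suc p-1

    Φ : Poly
    Φ = cyclotomic p

  infix 4 _~_
  _~_ : Poly → Poly → Set
  _~_ = CongruentMod ℤ[X] Φ

  ℤ[ζ] : CommutativeRing 0ℓ 0ℓ
  ℤ[ζ] = quotientRing ℤ[X] Φ

  private
    module P = CommutativeRing ℤ[X]
    module A = CommutativeRing ℤ[ζ]
  open Algebra.Properties.Semiring.Exp P.semiring using (_^_)
  open Algebra.Properties.Semiring.Mult P.semiring using (_×_; ×-comm-*; ×-assocˡ)
  private
    module A× = Algebra.Properties.Semiring.Mult A.semiring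
    module A^ = Algebra.Properties.Semiring.Exp A.semiring
  open P using (_+_; _*_; -_; 0#; 1#)

  -- Multiples and powers are defined from the bundle, so those of ℤ[ζ] and of ℤ[X] do not
  -- agree definitionally.
  ×≡ : ∀ n f → n A×.× f ≡ n × f
  ×≡ zero    f = ≡.refl
  ×≡ (suc n) f = ≡.cong (padd f) (×≡ n f)

  ^≡ : ∀ f n → f A^.^ n ≡ f ^ n
  ^≡ f zero    = ≡.refl
  ^≡ f (suc n) = ≡.cong (pmul f) (^≡ f n)

  π : Poly
  π = oneMinusX

  π*Φ : π * Φ ≃ 1# + - (X ^ p)
  π*Φ = geometric-1- ℤ[X] {X} cyclotomic (≃-refl {[]}) cyclotomic-suc p

  X^p~1 : X ^ p ~ 1#
  X^p~1 = mod (- π) (1-[1-x]g ℤ[X] {X} {X ^ p} {Φ} π*Φ)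

  Divides-resp : ∀ {f g} → f ≃ g → Divides p f → Divides p g
  Divides-resp e d i = ≡.subst (+ p ℤ.∣_) (at e i) (d i)

  π*[π^-Φ] : Divides p (π * (π ^ p-1 + - Φ))
  π*[π^-Φ] = Divides-resp (P.sym (proj₂ ∣π*)) (Divides-× p (proj₁ ∣π*))
    where ∣π* = [1-x]*[[1-x]^m-g] ℤ[X] pr {X} {Φ} π*Φ

  -- Since p divides π(π^(p-1) - Φ) and π has constant term 1, p divides π^(p-1) - Φ, and Φ is zero
  -- in Z[ζ]. This converts powers of π into powers of p.
  π^[p-1] : ∃[ v ] π ^ p-1 ~ p × v
  π^[p-1] = proj₁ quotient , mod 1#
    (P.trans (x≈[x-y]+y*1 ℤ[X] (π ^ p-1) Φ) (P.+-congʳ {Φ * 1#} (proj₂ quotient)))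
    where quotient = divide p (π ^ p-1 + - Φ) (Divides-cancel p (-[1+ 0 ] ∷ []) (π ^ p-1 + - Φ) π*[π^-Φ])

  -- If p f = Φ h, then p divides every coefficient of Φ h, hence of h because Φ has constant term
  -- 1; then p cancels in Z[X].
  ×-torsionFree : ∀ {f} → p × f ~ 0# → f ~ 0#
  ×-torsionFree {f} (mod h e) = mod k (×-cancel p f (0# + Φ * k) (begin
    p × f              ≈⟨ e ⟩
    Φ * h              ≈⟨ P.*-congˡ {Φ} (proj₂ quotient) ⟩
    Φ * (p × k)        ≈⟨ ×-comm-* p Φ k ⟩
    p × (Φ * k)        ∎))
    where
    open ≃-Reasoning
    quotient = divide p h (Divides-cancel p (cyclotomic p-1) h
      (Divides-resp (P.trans e (P.+-identityˡ (Φ * h))) (Divides-× p f)))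
    k = proj₁ quotient

  ×^-torsionFree : ∀ m {f} → (p ℕ.^ m) × f ~ 0# → f ~ 0#
  ×^-torsionFree zero    {f} h = A.trans (≈⇒~ ℤ[X] Φ (P.sym (P.+-identityʳ f))) h
  ×^-torsionFree (suc m) {f} h = ×^-torsionFree m (×-torsionFree (A.trans (≈⇒~ ℤ[X] Φ (×-assocˡ f p (p ℕ.^ m))) h))

  -- Evaluation at X = 1 turns the right side, including the cofactor multiple of Φ, into a multiple
  -- of p, while the left side is 1.
  1∉⟨π,p⟩ : ∀ g h → ¬ 1# ~ π * g + p × h
  1∉⟨π,p⟩ g h (mod k e) = ¬prime[1] (≡.subst Prime p≡1 pr)
    where
    open ≡.≡-Reasoning
    1≡ : + 1 ≡ (eval₁ h ℤ.+ eval₁ k) ℤ.* + p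
    1≡ = begin
      + 1                                             ≡⟨ eval₁-cong e ⟩
      eval₁ (π * g + p × h + Φ * k)                   ≡⟨ eval₁-padd (π * g + p × h) (Φ * k) ⟩
      eval₁ (π * g + p × h) ℤ.+ eval₁ (Φ * k)         ≡⟨ ≡.cong₂ ℤ._+_ (eval₁-padd (π * g) (p × h)) (eval₁-pmul Φ k) ⟩
      eval₁ (π * g) ℤ.+ eval₁ (p × h) ℤ.+ eval₁ Φ ℤ.* eval₁ k
        ≡⟨ ≡.cong₂ ℤ._+_ (≡.cong₂ ℤ._+_ (eval₁-pmul π g) (eval₁-× p h)) (≡.cong (ℤ._* eval₁ k) (eval₁-cyclotomic p)) ⟩
      + 0 ℤ.* eval₁ g ℤ.+ + p ℤ.* eval₁ h ℤ.+ + p ℤ.* eval₁ k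
        ≡⟨ ≡.cong (λ z → z ℤ.+ + p ℤ.* eval₁ h ℤ.+ + p ℤ.* eval₁ k) (ℤ.*-zeroˡ (eval₁ g)) ⟩
      + 0 ℤ.+ + p ℤ.* eval₁ h ℤ.+ + p ℤ.* eval₁ k     ≡⟨ ≡.cong (ℤ._+ + p ℤ.* eval₁ k) (ℤ.+-identityˡ (+ p ℤ.* eval₁ h)) ⟩
      + p ℤ.* eval₁ h ℤ.+ + p ℤ.* eval₁ k             ≡⟨ ℤ.*-distribˡ-+ (+ p) (eval₁ h) (eval₁ k) ⟨
      + p ℤ.* (eval₁ h ℤ.+ eval₁ k)                   ≡⟨ ℤ.*-comm (+ p) _ ⟩
      (eval₁ h ℤ.+ eval₁ k) ℤ.* + p                   ∎
    p≡1 : p ≡ 1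
    p≡1 = ℕ.∣1⇒≡1 (ℤ.∣⇒∣ᵤ {+ p} {+ 1} (ℤ.divides (eval₁ h ℤ.+ eval₁ k) 1≡))

  -- If ζ fixes s, so does every power of ζ, hence Φ(ζ)s = p s; but Φ(ζ) = 0 and there is no
  -- p-torsion. Character sums fixed by ζ vanish for this reason.
  X*s~s⇒s~0 : ∀ {s} → X * s ~ s → s ~ 0#
  X*s~s⇒s~0 {s} h = ×-torsionFree {s} (A.trans {p × s} {Φ * s} {0#} (A.sym {Φ * s} {p × s} Φ*s~p×s) (mod s (≃-refl {Φ * s})))
    where
    Φ*s~p×s : Φ * s ~ p × s
    Φ*s~p×s = ≡.subst (Φ * s ~_) (×≡ p s)
      (geometric-* ℤ[ζ] {X} {s} cyclotomic (A.refl {[]}) (λ k → ≈⇒~ ℤ[X] Φ (cyclotomic-suc k)) h p)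

  PiPowDivides⇒ : ∀ k {w} → PiPowDivides p k w → ∃[ g ] w ~ π ^ k * g
  PiPowDivides⇒ k {w} (g , h , e) = g , mod h (≡.subst (λ z → w ≃ z * g + Φ * h) (ppow-^ π k) (mk e))

  ⇒PiPowDivides : ∀ k {w g} → w ~ π ^ k * g → PiPowDivides p k w
  ⇒PiPowDivides k {w} {g} (mod h e) = g , h , at (≡.subst (λ z → w ≃ z * g + Φ * h) (≡.sym (ppow-^ π k)) e)

  -- Division by 1 - X in Horner's scheme; the remainder is the value at 1.
  remainder : ∀ w → ∃[ u ] w ≃ (eval₁ w ∷ []) + π * u
  remainder []      = [] , ≃-sym (P.trans (padd-cong 0∷[] (pmul-zeroʳ π)) (≃-refl {[]}))
  remainder (a ∷ w) = - (eval₁ w ∷ []) + X * u ,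
    P.trans (≃-sym (P.trans (P.+-congˡ {a ∷ []} (X-* w)) (∷-cong (ℤ.+-identityʳ a) (≃-refl {w}))))
      (horner-1-x ℤ[X] {w} {u} {a ∷ []} {eval₁ w ∷ []} {X} (proj₂ (remainder w)))
    where u = proj₁ (remainder w)

  p~π* : ∃[ u ] (+ p ∷ []) ~ π * u
  p~π* = - u , mod 1# (constant-term ℤ[X] {Φ} {+ p ∷ []} {π} {u}
    (≡.subst (λ c → Φ ≃ (c ∷ []) + π * u) (eval₁-cyclotomic p) (proj₂ (remainder Φ))))
    where u = proj₁ (remainder Φ)

  ×≃* : ∀ x → p × x ≃ (+ p ∷ []) * x
  ×≃* x = ≃-sym (P.trans (P.trans (P.+-congˡ {scale (+ p) x} 0∷[]) (padd-identityʳ (scale (+ p) x)))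
    (mk λ i → ≡.trans (coeff-scale (+ p) x i) (≡.sym (coeff-× p x i))))

  -- p is a multiple of π, so π-torsion is p-torsion.
  π-torsionFree : ∀ x → π * x ~ 0# → x ~ 0#
  π-torsionFree x h = ×-torsionFree {x} (A.trans (≈⇒~ ℤ[X] Φ (×≃* x)) (A.trans (A.*-congʳ {x} {+ p ∷ []} {π * u} (proj₂ p~π*))
    (A.trans (≈⇒~ ℤ[X] Φ (P.trans (P.*-congʳ {x} (P.*-comm π u)) (P.*-assoc u π x)))
      (A.trans (A.*-congˡ {u} {π * x} {0#} h) (A.zeroʳ u)))))
    where u = proj₁ p~π*

  p∣eval₁⇒π∣ : ∀ w → + p ℤ.∣ eval₁ w → ∃[ u ] w ~ π * u
  p∣eval₁⇒π∣ w (ℤ.divides c e) = v * (c ∷ []) + u , A.trans {j = π * (v * (c ∷ [])) + π * u}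
    (A.trans {j = (+ p ∷ []) * (c ∷ []) + π * u} (≈⇒~ ℤ[X] Φ w≃)
      (A.+-congʳ {π * u} (A.trans (A.*-congʳ {c ∷ []} {+ p ∷ []} {π * v} (proj₂ p~π*)) (A.*-assoc π v (c ∷ [])))))
    (A.sym (A.distribˡ π (v * (c ∷ [])) u))
    where
    u = proj₁ (remainder w)
    v = proj₁ p~π*
    w≃ : w ≃ (+ p ∷ []) * (c ∷ []) + π * u
    w≃ = P.trans (proj₂ (remainder w)) (P.+-congʳ {π * u}
      (∷-cong (≡.trans e (≡.trans (ℤ.*-comm c (+ p)) (≡.sym (ℤ.+-identityʳ _)))) (≃-refl {[]})))

  π∣⇒p∣eval₁ : ∀ {w u} → w ~ π * u → + p ℤ.∣ eval₁ w
  π∣⇒p∣eval₁ {w} {u} (mod h e) = ℤ.divides (eval₁ h) (begin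
    eval₁ w                                        ≡⟨ eval₁-cong e ⟩
    eval₁ (π * u + Φ * h)                          ≡⟨ eval₁-padd (π * u) (Φ * h) ⟩
    eval₁ (π * u) ℤ.+ eval₁ (Φ * h)                ≡⟨ ≡.cong₂ ℤ._+_ (eval₁-pmul π u) (eval₁-pmul Φ h) ⟩
    + 0 ℤ.* eval₁ u ℤ.+ eval₁ Φ ℤ.* eval₁ h        ≡⟨ ≡.cong₂ ℤ._+_ (ℤ.*-zeroˡ (eval₁ u)) (≡.cong (ℤ._* eval₁ h) (eval₁-cyclotomic p)) ⟩
    + 0 ℤ.+ + p ℤ.* eval₁ h                        ≡⟨ ≡.trans (ℤ.+-identityˡ _) (ℤ.*-comm (+ p) (eval₁ h)) ⟩
    eval₁ h ℤ.* + p                                ∎)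
    where open ≡.≡-Reasoning

  -- π divides w exactly when p divides w(1). The quotient u is then unique, as π is not a zero
  -- divisor, so the remaining power is tested on u.
  π^∣? : ∀ k w → Dec (∃[ g ] w ~ π ^ k * g)
  π^∣? zero    w = yes (w , ≈⇒~ ℤ[X] Φ (≃-sym (P.*-identityˡ w)))
  π^∣? (suc k) w = step (+ p ℤ.∣? eval₁ w)
    where
    assoc : ∀ g → π ^ suc k * g ~ π * (π ^ k * g)
    assoc g = ≈⇒~ ℤ[X] Φ (P.*-assoc π (π ^ k) g)
    step : Dec (+ p ℤ.∣ eval₁ w) → Dec (∃[ g ] w ~ π ^ suc k * g)
    step (no p∤) = no λ (g , h) → p∤ (π∣⇒p∣eval₁ {w} {π ^ k * g} (A.trans h (assoc g)))
    step (yes p∣) = map′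
      (λ (g , h) → g , A.trans w~πu (A.trans (A.*-congˡ {π} {u} {π ^ k * g} h) (A.sym (assoc g))))
      (λ (g , h) → g , *-cancelˡ-torsionFree ℤ[ζ] {π} π-torsionFree u (π ^ k * g)
        (A.trans (A.sym w~πu) (A.trans h (assoc g))))
      (π^∣? k u)
      where
      u = proj₁ (p∣eval₁⇒π∣ w p∣)
      w~πu = proj₂ (p∣eval₁⇒π∣ w p∣)

  -- Decidability lets the theorem find its witness by a search through F.
  PiPowDivides? : ∀ k w → Dec (PiPowDivides p k w)
  PiPowDivides? k w = map′ (λ (g , h) → ⇒PiPowDivides k {w} {g} h) (PiPowDivides⇒ k {w}) (π^∣? k w)

open import Data.Product using (_×_)
open ≡ using (refl; sym; trans; cong; cong₂; subst; subst₂; setoid; module ≡-Reasoning)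

-- Finite fields: sums and products over all elements, x^q = x, roots of polynomial functions

module _ (M : CommutativeMonoid 0ℓ 0ℓ) where
  open CommutativeMonoid M using (Carrier; _≈_; _∙_; ε; ∙-congˡ; identityʳ) renaming (setoid to ≈-setoid)
  open Algebra.Properties.CommutativeMonoid.Sum M

  sum-single : ∀ {n} (t : Fin n → Carrier) i → (∀ j → j ≢ i → t j ≈ ε) → sum t ≈ t i
  sum-single {suc n} t i h = begin
    sum t                        ≈⟨ sum-remove t ⟩
    t i ∙ sum (removeAt t i)     ≈⟨ ∙-congˡ (sum-cong-≋ λ j → h (Fin.punchIn i j) (Fin.punchInᵢ≢i i j)) ⟩
    t i ∙ sum {n} (λ _ → ε)      ≈⟨ ∙-congˡ (sum-replicate-zero n) ⟩
    t i ∙ ε                      ≈⟨ identityʳ (t i) ⟩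
    t i                          ∎
    where open Relation.Binary.Reasoning.Setoid ≈-setoid

module FiniteFieldProperties (F : FiniteField) where
  open FiniteField F
  open Inverse enum using (to; from; strictlyInverseˡ; strictlyInverseʳ)

  fieldRing : CommutativeRing 0ℓ 0ℓ
  fieldRing = record { isCommutativeRing = isCommutativeRing }

  private module R = CommutativeRing fieldRing
  open R public using
    ( +-identityˡ; +-identityʳ; +-assoc; *-identityˡ; *-identityʳ; *-comm; *-assoc
    ; zeroˡ; zeroʳ; -‿inverseʳ; distribˡ )
  open IntegerCoefficientSolver fieldRing public
  private
    module E = Algebra.Properties.Semiring.Exp R.semiring
    module CE = Algebra.Properties.CommutativeSemiring.Exp R.commutativeSemiring
    module M = Algebra.Properties.Semiring.Mult R.semiring

  pow≡^ : ∀ x k → pow x k ≡ x E.^ k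
  pow≡^ x zero    = refl
  pow≡^ x (suc k) = cong (x *_) (pow≡^ x k)

  embed≡× : ∀ k → embed k ≡ k M.× 1#
  embed≡× zero    = refl
  embed≡× (suc k) = cong (1# +_) (embed≡× k)

  pow-+ : ∀ x m n → pow x (m ℕ.+ n) ≡ pow x m * pow x n
  pow-+ x m n rewrite pow≡^ x (m ℕ.+ n) | pow≡^ x m | pow≡^ x n = E.^-homo-* x m n

  pow-pow : ∀ x m n → pow (pow x m) n ≡ pow x (m ℕ.* n)
  pow-pow x m n rewrite pow≡^ (pow x m) n | pow≡^ x m | pow≡^ x (m ℕ.* n) = E.^-assocʳ x m n

  pow-distrib-* : ∀ x y n → pow (x * y) n ≡ pow x n * pow y n
  pow-distrib-* x y n rewrite pow≡^ (x * y) n | pow≡^ x n | pow≡^ y n = CE.^-distrib-* x y n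

  pow-1# : ∀ k → pow 1# k ≡ 1#
  pow-1# k = trans (pow≡^ 1# k) (1^ fieldRing k)

  pow-0# : ∀ {k} → 0 ℕ.< k → pow 0# k ≡ 0#
  pow-0# {suc k} _ = zeroˡ _

  embed-+ : ∀ m n → embed (m ℕ.+ n) ≡ embed m + embed n
  embed-+ m n rewrite embed≡× (m ℕ.+ n) | embed≡× m | embed≡× n = M.×-homo-+ 1# m n

  embed-* : ∀ m n → embed (m ℕ.* n) ≡ embed m * embed n
  embed-* m n rewrite embed≡× (m ℕ.* n) | embed≡× m | embed≡× n = M.×1-homo-* m n

  embed-1 : embed 1 ≡ 1#
  embed-1 = +-identityʳ 1#

  x-y≡0⇒x≡y : ∀ {x y} → x + - y ≡ 0# → x ≡ y
  x-y≡0⇒x≡y {x} {y} e = trans (solve 2 (λ x y → x := (x :+ :- y) :+ y) refl x y)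
    (trans (cong (_+ y) e) (+-identityˡ y))

  x+y≡x⇒y≡0 : ∀ {x y} → x + y ≡ x → y ≡ 0#
  x+y≡x⇒y≡0 {x} {y} e = trans (solve 2 (λ x y → y := (x :+ y) :+ :- x) refl x y)
    (trans (cong (_+ - x) e) (-‿inverseʳ x))

  inv : ∀ x → x ≢ 0# → Carrier
  inv x x≢0 = proj₁ (inverse x x≢0)

  *-inv : ∀ x (x≢0 : x ≢ 0#) → x * inv x x≢0 ≡ 1#
  *-inv x x≢0 = proj₂ (inverse x x≢0)

  *-cancelˡ : ∀ {x y z} → x ≢ 0# → x * y ≡ x * z → y ≡ z
  *-cancelˡ {x} {y} {z} x≢0 e = begin
    y                    ≡⟨ h y ⟨
    inv x x≢0 * (x * y)  ≡⟨ cong (inv x x≢0 *_) e ⟩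
    inv x x≢0 * (x * z)  ≡⟨ h z ⟩
    z                    ∎
    where
    open ≡-Reasoning
    h : ∀ y → inv x x≢0 * (x * y) ≡ y
    h y = trans (solve 3 (λ i x y → i :* (x :* y) := (x :* i) :* y) refl (inv x x≢0) x y)
      (trans (cong (_* y) (*-inv x x≢0)) (*-identityˡ y))

  *≡0⇒≡0 : ∀ {x y} → x ≢ 0# → x * y ≡ 0# → y ≡ 0#
  *≡0⇒≡0 {x} x≢0 e = *-cancelˡ x≢0 (trans e (sym (zeroʳ x)))

  *-≢0 : ∀ {x y} → x ≢ 0# → y ≢ 0# → x * y ≢ 0#
  *-≢0 x≢0 y≢0 e = y≢0 (*≡0⇒≡0 x≢0 e)

  pow-≢0 : ∀ {x} k → x ≢ 0# → pow x k ≢ 0#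
  pow-≢0 zero    x≢0 e = 0≢1 (sym e)
  pow-≢0 (suc k) x≢0   = *-≢0 x≢0 (pow-≢0 k x≢0)

  inv-≢0 : ∀ x (x≢0 : x ≢ 0#) → inv x x≢0 ≢ 0#
  inv-≢0 x x≢0 e = 0≢1 (trans (sym (zeroʳ x)) (trans (cong (x *_) (sym e)) (*-inv x x≢0)))

  from-injective : Injective _≡_ _≡_ from
  from-injective {x} {y} e = trans (sym (strictlyInverseˡ x)) (trans (cong to e) (strictlyInverseˡ y))

  to-injective : Injective _≡_ _≡_ to
  to-injective {i} {j} e = trans (sym (strictlyInverseʳ i)) (trans (cong from e) (strictlyInverseʳ j))

  ∃? : ∀ {P : Pred Carrier 0ℓ} → Decidable P → Dec (∃[ x ] P x)
  ∃? {P} P? with Fin.any? (P? ∘ to)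
  ... | yes (i , h) = yes (to i , h)
  ... | no ¬∃       = no λ (x , h) → ¬∃ (from x , subst P (sym (strictlyInverseˡ x)) h)

  -- Pigeonhole: a missed value y placed in front of the image would inject q + 1 indices into q.
  injective⇒surjective : ∀ {f : Carrier → Carrier} → Injective _≡_ _≡_ f → ∀ y → ∃[ x ] f x ≡ y
  injective⇒surjective {f} inj y with ∃? (λ x → f x ≟ y)
  ... | yes h = h
  ... | no ¬h = contradiction (Fin.injective⇒≤ g-injective) ℕ.1+n≰n
    where
    g : Fin (suc size) → Fin size
    g zero    = from y
    g (suc i) = from (f (to i))
    g-injective : Injective _≡_ _≡_ g
    g-injective {zero}  {zero}  e = refl
    g-injective {zero}  {suc j} e = contradiction (to j , sym (from-injective e)) ¬h
    g-injective {suc i} {zero}  e = contradiction (to i , from-injective e) ¬h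
    g-injective {suc i} {suc j} e = cong suc (to-injective (inj (from-injective e)))

  *-bijection : ∀ a → a ≢ 0# → Carrier ↔ Carrier
  *-bijection a a≢0 = mk↔ₛ′ (a *_) (inv a a≢0 *_)
    (λ x → trans (sym (*-assoc _ _ _)) (trans (cong (_* x) (*-inv a a≢0)) (*-identityˡ x)))
    (λ x → trans (sym (*-assoc _ _ _)) (trans (cong (_* x) (trans (*-comm _ a) (*-inv a a≢0))) (*-identityˡ x)))

  +-bijection : ∀ a → Carrier ↔ Carrier
  +-bijection a = mk↔ₛ′ (a +_) (- a +_)
    (λ x → solve 2 (λ a x → a :+ (:- a :+ x) := x) refl a x)
    (λ x → solve 2 (λ a x → :- a :+ (a :+ x) := x) refl a x)

  -- Over an arbitrary commutative monoid because both readings occur: products in F for x^q = x,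
  -- and sums in Z[ζ] for the character.
  module FieldSum (M : CommutativeMonoid 0ℓ 0ℓ) where
    open CommutativeMonoid M using (_≈_; ε; _∙_) renaming (Carrier to C; reflexive to ≈-reflexive; trans to ≈-trans; rawMonoid to rawM)
    private module S = Algebra.Properties.CommutativeMonoid.Sum M
    open import Algebra.Definitions.RawMonoid rawM using () renaming (_×_ to _×ₘ_)

    ∑ : (Carrier → C) → C
    ∑ f = S.sum (f ∘ to)

    ∑-cong : ∀ {f g} → (∀ x → f x ≈ g x) → ∑ f ≈ ∑ g
    ∑-cong h = S.sum-cong-≋ (h ∘ to)

    ∑-const : ∀ v → ∑ (λ _ → v) ≈ size ×ₘ v
    ∑-const v = S.sum-replicate size

    ∑-distrib-∙ : ∀ f g → ∑ (λ x → f x ∙ g x) ≈ ∑ f ∙ ∑ g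
    ∑-distrib-∙ f g = S.∑-distrib-+ (f ∘ to) (g ∘ to)

    ∑-comm : ∀ (f : Carrier → Carrier → C) → ∑ (λ x → ∑ (f x)) ≈ ∑ (λ y → ∑ (λ x → f x y))
    ∑-comm f = S.∑-comm (λ i j → f (to i) (to j))

    ∑-bijection : ∀ (φ : Carrier ↔ Carrier) f → ∑ f ≈ ∑ (f ∘ Inverse.to φ)
    ∑-bijection φ f = ≈-trans (S.sum-permute (f ∘ to) (↔-trans enum (↔-trans φ (↔-sym enum))))
      (≈-reflexive (S.sum-cong-≗ λ i → cong f (strictlyInverseˡ (Inverse.to φ (to i)))))

    ∑-single : ∀ f x → (∀ y → y ≢ x → f y ≈ ε) → ∑ f ≈ f x
    ∑-single f x h = ≈-trans (sum-single M (f ∘ to) (from x) λ j j≢ → h (to j) λ e →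
        j≢ (trans (sym (strictlyInverseʳ j)) (cong from e)))
      (≈-reflexive (cong f (strictlyInverseˡ x)))

  private
    module Π where
      open FieldSum R.*-commutativeMonoid public
      import Algebra.Definitions.RawMonoid R.*-rawMonoid as RM
      ×≡pow : ∀ k x → k RM.× x ≡ pow x k
      ×≡pow zero    x = refl
      ×≡pow (suc k) x = cong (x *_) (×≡pow k x)
      open Algebra.Properties.CommutativeMonoid.Sum R.*-commutativeMonoid
      product-≢0 : ∀ {n} (t : Fin n → Carrier) → (∀ i → t i ≢ 0#) → sum t ≢ 0#
      product-≢0 {zero}  t h e = 0≢1 (sym e)
      product-≢0 {suc n} t h   = *-≢0 (h zero) (product-≢0 (t ∘ suc) (h ∘ suc))

  private
    ifZero_then_else_ : Carrier → Carrier → Carrier → Carrier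
    ifZero x then a else b = if does (x ≟ 0#) then a else b

    ifZero-yes : ∀ {x a b} → x ≡ 0# → ifZero x then a else b ≡ a
    ifZero-yes {x} {a} {b} e = cong (if_then a else b) (dec-true (x ≟ 0#) e)

    ifZero-no : ∀ {x a b} → x ≢ 0# → ifZero x then a else b ≡ b
    ifZero-no {x} {a} {b} e = cong (if_then a else b) (dec-false (x ≟ 0#) e)

  -- Multiplication by a ≠ 0 permutes F^*, so a^(q-1) = 1; products over F^* are
  -- written as products over F with the factor at 0 replaced by 1.
  pow-size : ∀ a → 0 ℕ.< size → pow a size ≡ a
  pow-size a 0<q with a ≟ 0#
  ... | yes refl = pow-0# 0<q
  ... | no a≢0 = begin
    pow a size                             ≡⟨ Π.×≡pow size a ⟨
    _                                      ≡⟨ Π.∑-const a ⟨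
    Π.∑ (λ _ → a)                          ≡⟨ Π.∑-cong split ⟩
    Π.∑ (λ x → onUnits x * atZero x)       ≡⟨ Π.∑-distrib-∙ onUnits atZero ⟩
    Π.∑ onUnits * Π.∑ atZero               ≡⟨ cong₂ _*_ ∏onUnits ∏atZero ⟩
    1# * a                                 ≡⟨ *-identityˡ a ⟩
    a                                      ∎
    where
    open ≡-Reasoning
    onUnits atZero unit : Carrier → Carrier
    onUnits x = ifZero x then 1# else a
    atZero  x = ifZero x then a else 1#
    unit    x = ifZero x then 1# else x

    split : ∀ x → a ≡ onUnits x * atZero x
    split x with x ≟ 0#
    ... | yes _ = sym (*-identityˡ a)
    ... | no  _ = sym (*-identityʳ a)

    ∏atZero : Π.∑ atZero ≡ a
    ∏atZero = trans (Π.∑-single atZero 0# λ y y≢0 → ifZero-no y≢0) (ifZero-yes refl)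

    unit-* : ∀ x → unit (a * x) ≡ onUnits x * unit x
    unit-* x with x ≟ 0#
    ... | yes refl = trans (ifZero-yes (zeroʳ a)) (sym (*-identityˡ 1#))
    ... | no x≢0   = ifZero-no (*-≢0 a≢0 x≢0)

    unit-≢0 : ∀ x → unit x ≢ 0#
    unit-≢0 x e with x ≟ 0#
    ... | yes _  = 0≢1 (sym e)
    ... | no x≢0 = x≢0 e

    ∏onUnits : Π.∑ onUnits ≡ 1#
    ∏onUnits = *-cancelˡ (Π.product-≢0 (unit ∘ to) (unit-≢0 ∘ to)) (begin
      Π.∑ unit * Π.∑ onUnits                 ≡⟨ *-comm _ _ ⟩
      Π.∑ onUnits * Π.∑ unit                 ≡⟨ Π.∑-distrib-∙ onUnits unit ⟨
      Π.∑ (λ x → onUnits x * unit x)         ≡⟨ Π.∑-cong unit-* ⟨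
      Π.∑ (λ x → unit (a * x))               ≡⟨ Π.∑-bijection (*-bijection a a≢0) unit ⟨
      Π.∑ unit                               ≡⟨ *-identityʳ _ ⟨
      Π.∑ unit * 1#                          ∎)

  -- Deg k f c: f is a polynomial function of degree at most k whose coefficient
  -- in degree k is c.
  Deg : ℕ → (Carrier → Carrier) → Carrier → Set
  Deg zero    f c = ∀ x → f x ≡ c
  Deg (suc k) f c = ∃[ g ] ∃[ a ] Deg k g c × (∀ x → f x ≡ a + x * g x)

  Deg-const : ∀ a → Deg 0 (λ _ → a) a
  Deg-const a x = refl

  Deg-raise : ∀ {k f c} → Deg k f c → Deg (suc k) f 0#
  Deg-raise {zero}  {c = c} h = (λ _ → 0#) , c , (λ _ → refl) , λ x →
    trans (h x) (sym (trans (cong (c +_) (zeroʳ x)) (+-identityʳ c)))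
  Deg-raise {suc k} (g , a , h , e) = g , a , Deg-raise h , e

  -- `Deg-+` requires equal formal degrees; raising the lower one, at the price of leading
  -- coefficient 0, lets it be added without disturbing the top coefficient.
  Deg-< : ∀ {k l f c} → k ℕ.< l → Deg k f c → Deg l f 0#
  Deg-< {k} k<l h with ℕ.m≤n⇒∃[o]m+o≡n k<l
  ... | o , refl = go o (Deg-raise h)
    where
    go : ∀ {k f} o → Deg (suc k) f 0# → Deg (suc k ℕ.+ o) f 0#
    go {k} {f} zero    h = subst (λ l → Deg l f 0#) (cong suc (sym (ℕ.+-identityʳ k))) h
    go {k} {f} (suc o) h = subst (λ l → Deg l f 0#) (cong suc (sym (ℕ.+-suc k o))) (Deg-raise (go o h))

  Deg-+ : ∀ {k f g c d} → Deg k f c → Deg k g d → Deg k (λ x → f x + g x) (c + d)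
  Deg-+ {zero}  h h′ x = cong₂ _+_ (h x) (h′ x)
  Deg-+ {suc k} (f , a , h , e) (g , b , h′ , e′) = (λ x → f x + g x) , a + b , Deg-+ h h′ , λ x →
    trans (cong₂ _+_ (e x) (e′ x))
      (solve 5 (λ a b x f g → (a :+ x :* f) :+ (b :+ x :* g) := (a :+ b) :+ x :* (f :+ g)) refl a b x (f x) (g x))

  Deg-x* : ∀ {k f c} → Deg k f c → Deg (suc k) (λ x → x * f x) c
  Deg-x* {f = f} h = f , 0# , h , λ x → sym (+-identityˡ _)

  Deg-pow : ∀ k → Deg k (λ x → pow x k) 1#
  Deg-pow zero    = Deg-const 1#
  Deg-pow (suc k) = Deg-x* (Deg-pow k)

  Deg-linear : ∀ a b → Deg 1 (λ x → a + x * b) b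
  Deg-linear a b = (λ _ → b) , a , (λ _ → refl) , λ _ → refl

  Deg-ext : ∀ {k f g c} → (∀ x → f x ≡ g x) → Deg k f c → Deg k g c
  Deg-ext {zero}  e h x = trans (sym (e x)) (h x)
  Deg-ext {suc k} e (g , a , h , e′) = g , a , h , λ x → trans (sym (e x)) (e′ x)

  -- Synthetic division at r: the remainder is f(r), and the quotient keeps the leading coefficient.
  Deg-factor : ∀ {k f c} → Deg (suc k) f c → ∀ r →
               ∃[ g ] Deg k g c × (∀ x → f x ≡ f r + (x + - r) * g x)
  Deg-factor {zero} {c = c} (g , a , h , e) r = (λ _ → c) , (λ _ → refl) , λ x → trans (e x) (trans (cong (λ z → a + x * z) (h x))
    (trans (solve 4 (λ a x r c → a :+ x :* c := (a :+ r :* c) :+ (x :+ :- r) :* c) refl a x r c)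
      (cong (_+ (x + - r) * c) (sym (trans (e r) (cong (λ z → a + r * z) (h r)))))))
  Deg-factor {suc k} {f} (g , a , h , e) r with Deg-factor h r
  ... | g′ , h′ , e′ = (λ x → g r + x * g′ x) , (g′ , g r , h′ , λ x → refl) , λ x → begin
    f x                                          ≡⟨ e x ⟩
    a + x * g x                                  ≡⟨ cong (λ z → a + x * z) (e′ x) ⟩
    a + x * (g r + (x + - r) * g′ x)             ≡⟨ solve 5 (λ a x gr r gx → a :+ x :* (gr :+ (x :+ :- r) :* gx)
                                                      := (a :+ r :* gr) :+ (x :+ :- r) :* (gr :+ x :* gx)) refl a x (g r) r (g′ x) ⟩
    (a + r * g r) + (x + - r) * (g r + x * g′ x) ≡⟨ cong (_+ (x + - r) * (g r + x * g′ x)) (sym (e r)) ⟩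
    f r + (x + - r) * (g r + x * g′ x)           ∎
    where open ≡-Reasoning

  -- Dividing out k of the roots one at a time leaves the constant c, which still vanishes at the
  -- last root.
  Deg-roots : ∀ {k f c} → Deg k f c → (r : Fin (suc k) → Carrier) → Injective _≡_ _≡_ r →
              (∀ i → f (r i) ≡ 0#) → c ≡ 0#
  Deg-roots {zero}  h r r-inj e = trans (sym (h (r zero))) (e zero)
  Deg-roots {suc k} {f} h r r-inj e with Deg-factor h (r zero)
  ... | g , h′ , e′ = Deg-roots h′ (r ∘ suc) (Fin.suc-injective ∘ r-inj) λ i → *≡0⇒≡0
    (λ r≡ → contradiction (r-inj (x-y≡0⇒x≡y r≡)) λ ())
    (trans (sym (+-identityˡ _)) (trans (cong (_+ _) (sym (e zero)))
      (trans (sym (e′ (r (suc i)))) (e (suc i)))))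

  Deg-vanishing : ∀ {k f c} → Deg k f c → k ℕ.< size → (∀ x → f x ≡ 0#) → c ≡ 0#
  Deg-vanishing h k<q e = Deg-roots h (λ i → to (Fin.inject≤ i k<q))
    (λ e → Fin.inject≤-injective k<q k<q _ _ (to-injective e)) (λ i → e _)

-- Characteristic p: Frobenius, the prime field and the absolute trace

module CharacteristicP (F : FiniteField) (p n : ℕ) (pr : Prime p)
  (char : FiniteField.embed F p ≡ FiniteField.0# F) (size≡ : FiniteField.size F ≡ p ℕ.^ n) where
  open FiniteField F
  open FiniteFieldProperties F
  open ≡-Reasoning

  instance
    nonZero-p : ℕ.NonZero p
    nonZero-p = prime⇒nonZero pr

  1<p : 1 ℕ.< p
  1<p = ℕ.nonTrivial⇒n>1 p {{prime⇒nonTrivial pr}}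

  0<p : 0 ℕ.< p
  0<p = ℕ.<-trans (s≤s z≤n) 1<p

  0<p^ : ∀ k → 0 ℕ.< p ℕ.^ k
  0<p^ k = ℕ.m^n>0 p k

  0<size : 0 ℕ.< size
  0<size = subst (0 ℕ.<_) (sym size≡) (0<p^ n)

  frobenius-+ : ∀ x y → pow (x + y) p ≡ pow x p + pow y p
  frobenius-+ x y = x-y≡0⇒x≡y (begin
    pow (x + y) p + - (pow x p + pow y p)
      ≡⟨ cong₂ (λ u v → u + - v) (pow≡^ (x + y) p) (cong₂ _+_ (pow≡^ x p) (pow≡^ y p)) ⟩
    _                         ≡⟨ proj₂ f ⟩
    p M.× w                   ≡⟨ cong (p M.×_) (*-identityˡ w) ⟨
    p M.× (1# * w)            ≡⟨ M.×-assoc-* p 1# w ⟨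
    (p M.× 1#) * w            ≡⟨ cong (_* w) (trans (sym (embed≡× p)) char) ⟩
    0# * w                    ≡⟨ zeroˡ w ⟩
    0#                        ∎)
    where
    module M = Algebra.Properties.Semiring.Mult (CommutativeRing.semiring fieldRing)
    f = freshman fieldRing pr x y
    w = proj₁ f

  frobenius^-+ : ∀ i x y → pow (x + y) (p ℕ.^ i) ≡ pow x (p ℕ.^ i) + pow y (p ℕ.^ i)
  frobenius^-+ zero x y = solve 2 (λ x y → (x :+ y) :* con (ℤ.+ 1) := x :* con (ℤ.+ 1) :+ y :* con (ℤ.+ 1)) refl x y
  frobenius^-+ (suc i) x y = begin
    pow (x + y) (p ℕ.* p ℕ.^ i)                              ≡⟨ pow-pow (x + y) p (p ℕ.^ i) ⟨
    pow (pow (x + y) p) (p ℕ.^ i)                            ≡⟨ cong (λ z → pow z (p ℕ.^ i)) (frobenius-+ x y) ⟩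
    pow (pow x p + pow y p) (p ℕ.^ i)                        ≡⟨ frobenius^-+ i (pow x p) (pow y p) ⟩
    pow (pow x p) (p ℕ.^ i) + pow (pow y p) (p ℕ.^ i)        ≡⟨ cong₂ _+_ (pow-pow x p (p ℕ.^ i)) (pow-pow y p (p ℕ.^ i)) ⟩
    pow x (p ℕ.* p ℕ.^ i) + pow y (p ℕ.* p ℕ.^ i)            ∎

  embed-frobenius : ∀ m → pow (embed m) p ≡ embed m
  embed-frobenius zero    = pow-0# 0<p
  embed-frobenius (suc m) = trans (frobenius-+ 1# (embed m)) (cong₂ _+_ (pow-1# p) (embed-frobenius m))

  embed-*p : ∀ k → embed (k ℕ.* p) ≡ 0#
  embed-*p k = trans (embed-* k p) (trans (cong (embed k *_) char) (zeroʳ _))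

  embed-% : ∀ m → embed (m ℕ.% p) ≡ embed m
  embed-% m = begin
    embed (m ℕ.% p)                               ≡⟨ +-identityʳ _ ⟨
    embed (m ℕ.% p) + 0#                          ≡⟨ cong (embed (m ℕ.% p) +_) (embed-*p (m ℕ./ p)) ⟨
    embed (m ℕ.% p) + embed (m ℕ./ p ℕ.* p)       ≡⟨ embed-+ (m ℕ.% p) (m ℕ./ p ℕ.* p) ⟨
    embed (m ℕ.% p ℕ.+ m ℕ./ p ℕ.* p)             ≡⟨ cong embed (sym (ℕ.m≡m%n+[m/n]*n m p)) ⟩
    embed m                                       ∎

  -- Bézout writes 1 as a difference of multiples of p and k, both of which would vanish in F.
  embed-≢0 : ∀ {k} → 0 ℕ.< k → k ℕ.< p → embed k ≢ 0#
  embed-≢0 {suc k} 0<k k<p e with coprime-Bézout (prime⇒coprime pr k<p)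
  ... | Bézout.+- x y eq = 0≢1 (begin
    0#                                   ≡⟨ embed-*p x ⟨
    embed (x ℕ.* p)                      ≡⟨ cong embed eq ⟨
    1# + embed (y ℕ.* suc k)             ≡⟨ cong (1# +_) (trans (embed-* y (suc k)) (trans (cong (embed y *_) e) (zeroʳ _))) ⟩
    1# + 0#                              ≡⟨ +-identityʳ 1# ⟩
    1#                                   ∎)
  ... | Bézout.-+ x y eq = 0≢1 (begin
    0#                                   ≡⟨ trans (embed-* y (suc k)) (trans (cong (embed y *_) e) (zeroʳ _)) ⟨
    embed (y ℕ.* suc k)                  ≡⟨ cong embed eq ⟨
    1# + embed (x ℕ.* p)                 ≡⟨ cong (1# +_) (embed-*p x) ⟩
    1# + 0#                              ≡⟨ +-identityʳ 1# ⟩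
    1#                                   ∎)

  embed-∤ : ∀ {k} → ¬ p ℕ.∣ k → embed k ≢ 0#
  embed-∤ {k} p∤k e = embed-≢0 (ℕ.n≢0⇒n>0 (p∤k ∘ ℕ.m%n≡0⇒n∣m k p)) (ℕ.m%n<n k p) (trans (embed-% k) e)

  embed-injective-≤ : ∀ {a b} → a ℕ.≤ b → b ℕ.< p → embed a ≡ embed b → a ≡ b
  embed-injective-≤ {a} {b} a≤b b<p e with ℕ.m≤n⇒∃[o]m+o≡n a≤b
  ... | zero  , refl = sym (ℕ.+-identityʳ a)
  ... | suc o , refl = contradiction (x+y≡x⇒y≡0 (trans (sym (embed-+ a (suc o))) (sym e)))
    (embed-≢0 (s≤s z≤n) (ℕ.≤-<-trans (ℕ.m≤n+m (suc o) a) b<p))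

  embed-injective : ∀ {a b} → a ℕ.< p → b ℕ.< p → embed a ≡ embed b → a ≡ b
  embed-injective {a} {b} a<p b<p e with ℕ.≤-total a b
  ... | inj₁ a≤b = embed-injective-≤ a≤b b<p e
  ... | inj₂ b≤a = sym (embed-injective-≤ b≤a a<p (sym e))

  -- Otherwise y and the p distinct elements `embed i` would be p + 1 roots of x^p - x, whose
  -- leading coefficient is 1.
  primeField : ∀ y → pow y p ≡ y → ∃[ m ] m ℕ.< p × embed m ≡ y
  primeField y y^p≡y with Fin.any? (λ (i : Fin p) → embed (toℕ i) ≟ y)
  ... | yes (i , e) = toℕ i , Fin.toℕ<n i , e
  ... | no ¬∃ = contradiction (trans (sym leading) (Deg-roots deg r r-injective r-root)) (0≢1 ∘ sym)
    where
    deg : Deg p (λ x → pow x p + (0# + x * - 1#)) (1# + 0#)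
    deg = Deg-+ (Deg-pow p) (Deg-< 1<p (Deg-linear 0# (- 1#)))
    leading : 1# + 0# ≡ 1#
    leading = +-identityʳ 1#
    r : Fin (suc p) → Carrier
    r zero    = y
    r (suc i) = embed (toℕ i)
    r-injective : Injective _≡_ _≡_ r
    r-injective {zero}  {zero}  e = refl
    r-injective {zero}  {suc j} e = contradiction (j , sym e) ¬∃
    r-injective {suc i} {zero}  e = contradiction (i , e) ¬∃
    r-injective {suc i} {suc j} e = cong suc (Fin.toℕ-injective (embed-injective (Fin.toℕ<n i) (Fin.toℕ<n j) e))
    fixed⇒root : ∀ {x} → pow x p ≡ x → pow x p + (0# + x * - 1#) ≡ 0#
    fixed⇒root {x} e = trans (cong (_+ _) e)
      (solve 1 (λ x → x :+ (con (ℤ.+ 0) :+ x :* :- con (ℤ.+ 1)) := con (ℤ.+ 0)) refl x)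
    r-root : ∀ i → pow (r i) p + (0# + r i * - 1#) ≡ 0#
    r-root zero    = fixed⇒root y^p≡y
    r-root (suc i) = fixed⇒root (embed-frobenius (toℕ i))

  Tr : Carrier → Carrier
  Tr = trace p n

  trace-+ : ∀ i x y → trace p i (x + y) ≡ trace p i x + trace p i y
  trace-+ zero    x y = sym (+-identityˡ 0#)
  trace-+ (suc i) x y = trans (cong₂ _+_ (frobenius^-+ i x y) (trace-+ i x y))
    (solve 4 (λ a b c d → (a :+ b) :+ (c :+ d) := (a :+ c) :+ (b :+ d)) refl (pow x (p ℕ.^ i)) _ (trace p i x) _)

  fixed-^ : ∀ {c} → pow c p ≡ c → ∀ i → pow c (p ℕ.^ i) ≡ c
  fixed-^ {c} e zero    = *-identityʳ c
  fixed-^ {c} e (suc i) = trans (sym (pow-pow c p (p ℕ.^ i))) (trans (cong (λ z → pow z (p ℕ.^ i)) e) (fixed-^ e i))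

  trace-* : ∀ {c} → pow c p ≡ c → ∀ i x → trace p i (c * x) ≡ c * trace p i x
  trace-* {c} e zero    x = sym (zeroʳ c)
  trace-* {c} e (suc i) x = begin
    pow (c * x) (p ℕ.^ i) + trace p i (c * x)
      ≡⟨ cong₂ _+_ (trans (pow-distrib-* c x (p ℕ.^ i)) (cong (_* pow x (p ℕ.^ i)) (fixed-^ e i))) (trace-* e i x) ⟩
    c * pow x (p ℕ.^ i) + c * trace p i x
      ≡⟨ distribˡ c _ _ ⟨
    c * trace p (suc i) x ∎

  -- The p-th power shifts each summand x^(p^j) to the next, so only the two ends differ. At i = n
  -- the ends agree by x^q = x, which puts the trace in the prime field.
  trace-frobenius : ∀ i x → pow (trace p i x) p + x ≡ trace p i x + pow x (p ℕ.^ i)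
  trace-frobenius zero    x = cong₂ _+_ (pow-0# 0<p) (sym (*-identityʳ x))
  trace-frobenius (suc i) x = begin
    pow (y + t) p + x                    ≡⟨ cong (_+ x) (frobenius-+ y t) ⟩
    (pow y p + pow t p) + x              ≡⟨ +-assoc (pow y p) (pow t p) x ⟩
    pow y p + (pow t p + x)              ≡⟨ cong (pow y p +_) (trace-frobenius i x) ⟩
    pow y p + (t + y)                    ≡⟨ cong (_+ (t + y)) (trans (pow-pow x (p ℕ.^ i) p) (cong (pow x) (ℕ.*-comm (p ℕ.^ i) p))) ⟩
    pow x (p ℕ.^ suc i) + (t + y)        ≡⟨ solve 3 (λ a t y → a :+ (t :+ y) := (y :+ t) :+ a) refl (pow x (p ℕ.^ suc i)) t y ⟩
    (y + t) + pow x (p ℕ.^ suc i)        ∎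
    where
    y = pow x (p ℕ.^ i)
    t = trace p i x

  Tr-fixed : ∀ x → pow (Tr x) p ≡ Tr x
  Tr-fixed x = x-y≡0⇒x≡y (begin
    pow (Tr x) p + - Tr x              ≡⟨ solve 3 (λ a t x → a :+ :- t := (a :+ x) :+ :- (t :+ x)) refl (pow (Tr x) p) (Tr x) x ⟩
    (pow (Tr x) p + x) + - (Tr x + x)  ≡⟨ cong (_+ - (Tr x + x)) (trans (trace-frobenius n x) (cong (Tr x +_)
                                            (trans (cong (pow x) (sym size≡)) (pow-size x 0<size)))) ⟩
    (Tr x + x) + - (Tr x + x)          ≡⟨ -‿inverseʳ _ ⟩
    0#                                 ∎)

  abstract
    -- The representative in [0, p) of the trace.
    res : Carrier → ℕ
    res x = proj₁ (primeField (Tr x) (Tr-fixed x))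

    res<p : ∀ x → res x ℕ.< p
    res<p x = proj₁ (proj₂ (primeField (Tr x) (Tr-fixed x)))

    embed-res : ∀ x → embed (res x) ≡ Tr x
    embed-res x = proj₂ (proj₂ (primeField (Tr x) (Tr-fixed x)))

  res-+ : ∀ x y → embed (res (x + y)) ≡ embed (res x ℕ.+ res y)
  res-+ x y = trans (embed-res (x + y)) (trans (trace-+ n x y)
    (trans (sym (cong₂ _+_ (embed-res x) (embed-res y))) (sym (embed-+ (res x) (res y)))))

  -- The exponents that occur stay below p^i, so the coefficient in degree p^i is 0; the next
  -- summand x^(p^i) then supplies the leading coefficient 1.
  trace-Deg : ∀ i → Deg (p ℕ.^ i) (trace p i) 0#
  trace-Deg zero    = Deg-raise (Deg-const 0#)
  trace-Deg (suc i) = Deg-< (ℕ.^-monoʳ-< p 1<p (ℕ.n<1+n i)) (Deg-+ (Deg-pow (p ℕ.^ i)) (trace-Deg i))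

  0<n : 0 ℕ.< n
  0<n = ℕ.n≢0⇒n>0 λ n≡0 → 0≢1 (from-injective
    (Fin-1 (trans size≡ (cong (p ℕ.^_) n≡0)) (Inverse.from enum 0#) (Inverse.from enum 1#)))
    where
    Fin-1 : ∀ {m} → m ≡ 1 → (i j : Fin m) → i ≡ j
    Fin-1 refl zero zero = refl

  -- As a polynomial the trace is monic of degree p^(n-1) < q, so it cannot vanish on all of F.
  trace-nonzero : ∃[ u ] Tr u ≢ 0#
  trace-nonzero with ∃? (λ u → ¬? (Tr u ≟ 0#))
  ... | yes h = h
  ... | no ¬∃ = contradiction (go n 0<n size≡ λ x → decidable-stable (Tr x ≟ 0#) λ h → ¬∃ (x , h)) (0≢1 ∘ sym)
    where
    go : ∀ n → 0 ℕ.< n → size ≡ p ℕ.^ n → (∀ x → trace p n x ≡ 0#) → 1# ≡ 0#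
    go (suc m) _ size≡ h = trans (sym (+-identityʳ 1#))
      (Deg-vanishing (Deg-+ (Deg-pow (p ℕ.^ m)) (trace-Deg m))
        (subst (p ℕ.^ m ℕ.<_) (sym size≡) (ℕ.^-monoʳ-< p 1<p (ℕ.n<1+n m))) h)

  abstract
    -- c = Tr u lies in the prime field, hence so does 1/c, and the trace is linear over that field:
    -- u/c has trace 1.
    trace-one : ∃[ u ] Tr u ≡ 1#
    trace-one with trace-nonzero
    ... | u , c≢0 = i * u , trans (trace-* i-fixed n u) (trans (*-comm i c) (*-inv c c≢0))
      where
      c : Carrier
      c = Tr u
      i : Carrier
      i = inv c c≢0
      i-fixed : pow i p ≡ i
      i-fixed = *-cancelˡ c≢0 (begin
        c * pow i p         ≡⟨ cong (_* pow i p) (Tr-fixed u) ⟨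
        pow c p * pow i p   ≡⟨ pow-distrib-* c i p ⟨
        pow (c * i) p       ≡⟨ cong (λ z → pow z p) (*-inv c c≢0) ⟩
        pow 1# p            ≡⟨ pow-1# p ⟩
        1#                  ≡⟨ *-inv c c≢0 ⟨
        c * i               ∎)

-- The exponent d: powers of p in it, the permutation x ↦ x^d, counting solutions

splitPower : ∀ {p} → Prime p → ∀ k → 0 ℕ.< k → ∃₂ λ a m → k ≡ p ℕ.^ a ℕ.* m × ¬ p ℕ.∣ m
splitPower {p} pr = <-rec _ step
  where
  instance _ = prime⇒nonZero pr
  step : ∀ k → (∀ {j} → j ℕ.< k → 0 ℕ.< j → ∃₂ λ a m → j ≡ p ℕ.^ a ℕ.* m × ¬ p ℕ.∣ m) →
         0 ℕ.< k → ∃₂ λ a m → k ≡ p ℕ.^ a ℕ.* m × ¬ p ℕ.∣ m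
  step k rec 0<k with p ℕ.∣? k
  ... | no p∤k = 0 , k , sym (ℕ.*-identityˡ k) , p∤k
  ... | yes (ℕ.divides j refl) with rec j<jp 0<j
    where
    0<j : 0 ℕ.< j
    0<j = ℕ.n≢0⇒n>0 λ { refl → ℕ.<-irrefl refl 0<k }
    j<jp : j ℕ.< j ℕ.* p
    j<jp = ℕ.m<m*n j p {{ℕ.>-nonZero 0<j}} (ℕ.nonTrivial⇒n>1 p {{prime⇒nonTrivial pr}})
  ... | a , m , refl , p∤m = suc a , m ,
    trans (ℕ.*-comm (p ℕ.^ a ℕ.* m) p) (sym (ℕ.*-assoc p (p ℕ.^ a) m)) , p∤m

module PermutationExponent (F : FiniteField) (d : ℕ) (0<d : 0 ℕ.< d) (0<size : 0 ℕ.< FiniteField.size F)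
  (coprime : gcd d (FiniteField.size F ℕ.∸ 1) ≡ 1) where
  open FiniteField F
  open FiniteFieldProperties F
  open ≡-Reasoning

  pow-order : ∀ {a} → a ≢ 0# → pow a (size ℕ.∸ 1) ≡ 1#
  pow-order {a} a≢0 = *-cancelˡ a≢0 (begin
    pow a (suc (size ℕ.∸ 1))   ≡⟨ cong (pow a) (ℕ.m+[n∸m]≡n 0<size) ⟩
    pow a size               ≡⟨ pow-size a 0<size ⟩
    a                        ≡⟨ *-identityʳ a ⟨
    a * 1#                   ∎)

  pow-order-* : ∀ {a} → a ≢ 0# → ∀ k → pow a (k ℕ.* (size ℕ.∸ 1)) ≡ 1#
  pow-order-* {a} a≢0 k = trans (cong (pow a) (ℕ.*-comm k (size ℕ.∸ 1)))
    (trans (sym (pow-pow a (size ℕ.∸ 1) k)) (trans (cong (λ z → pow z k) (pow-order a≢0)) (pow-1# k)))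

  -- Bézout for d and q - 1 inverts the exponent, since a^(q-1) = 1 for a ≠ 0.
  root : ∀ a → ∃[ r ] pow r d ≡ a
  root a with a ≟ 0#
  ... | yes refl = 0# , pow-0# 0<d
  ... | no a≢0 with Bézout.identity (subst (λ g → GCD d (size ℕ.∸ 1) g) coprime (gcd-GCD d (size ℕ.∸ 1)))
  ... | Bézout.+- x y eq = pow a x , (begin
    pow (pow a x) d                       ≡⟨ pow-pow a x d ⟩
    pow a (x ℕ.* d)                       ≡⟨ cong (pow a) eq ⟨
    a * pow a (y ℕ.* (size ℕ.∸ 1))          ≡⟨ cong (a *_) (pow-order-* a≢0 y) ⟩
    a * 1#                                ≡⟨ *-identityʳ a ⟩
    a                                     ∎)
  -- Here x d + 1 is a multiple of q - 1, so d has inverse -x and the power is taken of b = 1/a.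
  ... | Bézout.-+ x y eq = pow b x , *-cancelˡ (inv-≢0 a a≢0) (begin
    b * pow (pow b x) d                   ≡⟨ cong (b *_) (pow-pow b x d) ⟩
    pow b (suc (x ℕ.* d))                 ≡⟨ cong (pow b) eq ⟩
    pow b (y ℕ.* (size ℕ.∸ 1))              ≡⟨ pow-order-* (inv-≢0 a a≢0) y ⟩
    1#                                    ≡⟨ *-inv a a≢0 ⟨
    a * b                                 ≡⟨ *-comm a b ⟩
    b * a                                 ∎)
    where b = inv a a≢0

  -- `root` is injective because the d-th power undoes it, hence onto by finiteness; so x and y are
  -- values of `root`, and their d-th powers recover its arguments.
  pow-d-injective : ∀ {x y} → pow x d ≡ pow y d → x ≡ y
  pow-d-injective {x} {y} e = begin
    x                       ≡⟨ proj₂ (root-surjective x) ⟨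
    proj₁ (root a)          ≡⟨ cong (proj₁ ∘ root) (begin
      a                       ≡⟨ proj₂ (root a) ⟨
      pow (proj₁ (root a)) d  ≡⟨ cong (λ z → pow z d) (proj₂ (root-surjective x)) ⟩
      pow x d                 ≡⟨ e ⟩
      pow y d                 ≡⟨ cong (λ z → pow z d) (proj₂ (root-surjective y)) ⟨
      pow (proj₁ (root b)) d  ≡⟨ proj₂ (root b) ⟩
      b                       ∎) ⟩
    proj₁ (root b)          ≡⟨ proj₂ (root-surjective y) ⟩
    y                       ∎
    where
    root-surjective : ∀ y → ∃[ a ] proj₁ (root a) ≡ y
    root-surjective = injective⇒surjective λ {a} {b} e →
      trans (sym (proj₂ (root a))) (trans (cong (λ z → pow z d) e) (proj₂ (root b)))
    a = proj₁ (root-surjective x)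
    b = proj₁ (root-surjective y)

  -- For fixed B ≠ 0, 1 a solution t₀ of (t+1)^d = t^d + B would extend C ↦ t(C) to an
  -- injection F → F whose image misses 0.
  pow-d-additive : (∀ B C → B ≢ 0# → C ≢ 0# → C ≢ 1# → ∃[ t ] pow (t + 1#) d ≡ C * pow t d + B) →
                   ∀ t → pow (t + 1#) d ≡ pow t d + 1#
  pow-d-additive solvable t₀ with (pow (t₀ + 1#) d + - pow t₀ d) ≟ 1#
  ... | yes B≡1 = trans (solve 2 (λ x y → x := y :+ (x :+ :- y)) refl (pow (t₀ + 1#) d) (pow t₀ d)) (cong (pow t₀ d +_) B≡1)
  ... | no B≢1 = contradiction (proj₂ (injective⇒surjective (λ {C} {C′} → sol-injective {C} {C′}) 0#)) (sol-≢0 _)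
    where
    B = pow (t₀ + 1#) d + - pow t₀ d
    B≢0 : B ≢ 0#
    B≢0 e = 0≢1 (sym (x+y≡x⇒y≡0 (pow-d-injective (x-y≡0⇒x≡y e))))

    Solution : Carrier → Set
    Solution C = ∃[ t ] pow (t + 1#) d ≡ C * pow t d + B

    solution : ∀ C → Solution C
    solution C with C ≟ 1#
    ... | yes refl = t₀ , solve 2 (λ x y → x := con (ℤ.+ 1) :* y :+ (x :+ :- y)) refl (pow (t₀ + 1#) d) (pow t₀ d)
    ... | no C≢1 with C ≟ 0#
    ... | no C≢0 = solvable B C B≢0 C≢0 C≢1
    -- For C = 0 the equation reads (t+1)^d = B, which a d-th root of B solves directly.
    ... | yes refl = r + - 1# , (begin
      pow ((r + - 1#) + 1#) d      ≡⟨ cong (λ z → pow z d) (solve 1 (λ r → (r :+ :- con (ℤ.+ 1)) :+ con (ℤ.+ 1) := r) refl r) ⟩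
      pow r d                      ≡⟨ proj₂ (root B) ⟩
      B                            ≡⟨ solve 2 (λ b x → b := con (ℤ.+ 0) :* x :+ b) refl B (pow (r + - 1#) d) ⟩
      0# * pow (r + - 1#) d + B    ∎)
      where r = proj₁ (root B)

    sol : Carrier → Carrier
    sol C = proj₁ (solution C)

    -- At t = 0 the equation would read 1 = B.
    sol-≢0 : ∀ C → sol C ≢ 0#
    sol-≢0 C e = B≢1 (sym (begin
      1#                       ≡⟨ pow-1# d ⟨
      pow 1# d                 ≡⟨ cong (λ z → pow z d) (trans (cong (_+ 1#) e) (+-identityˡ 1#)) ⟨
      pow (sol C + 1#) d       ≡⟨ proj₂ (solution C) ⟩
      C * pow (sol C) d + B    ≡⟨ cong (λ z → C * z + B) (trans (cong (λ z → pow z d) e) (pow-0# 0<d)) ⟩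
      C * 0# + B               ≡⟨ solve 2 (λ c b → c :* con (ℤ.+ 0) :+ b := b) refl C B ⟩
      B                        ∎))

    -- As t ≠ 0, the equation can be solved for C, so t determines C.
    sol-injective : Injective _≡_ _≡_ sol
    sol-injective {C} {C′} e = *-cancelˡ (pow-≢0 d (sol-≢0 C)) (begin
      s * C                      ≡⟨ solve 3 (λ s c b → s :* c := (c :* s :+ b) :+ :- b) refl s C B ⟩
      (C * s + B) + - B          ≡⟨ cong (_+ - B) (trans (sym (proj₂ (solution C))) (trans (cong (λ z → pow (z + 1#) d) e)
                                      (trans (proj₂ (solution C′)) (cong (λ z → C′ * pow z d + B) (sym e))))) ⟩
      (C′ * s + B) + - B         ≡⟨ solve 3 (λ s c b → s :* c := (c :* s :+ b) :+ :- b) refl s C′ B ⟨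
      s * C′                     ∎)
      where s = pow (sol C) d

-- Exponents with (t+1)^d = t^d + 1 are powers of p modulo q - 1

module AdditivePower (F : FiniteField) (p n : ℕ) (pr : Prime p)
  (char : FiniteField.embed F p ≡ FiniteField.0# F) (size≡ : FiniteField.size F ≡ p ℕ.^ n) where
  open FiniteField F
  open FiniteFieldProperties F
  open CharacteristicP F p n pr char size≡
  open ≡-Reasoning

  frobenius^-injective : ∀ i {x y} → pow x (p ℕ.^ i) ≡ pow y (p ℕ.^ i) → x ≡ y
  frobenius^-injective i {x} {y} e with (x + - y) ≟ 0#
  ... | yes h = x-y≡0⇒x≡y h
  ... | no ¬h = contradiction (x+y≡x⇒y≡0 (begin
    pow y (p ℕ.^ i) + pow (x + - y) (p ℕ.^ i)   ≡⟨ frobenius^-+ i y (x + - y) ⟨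
    pow (y + (x + - y)) (p ℕ.^ i)               ≡⟨ cong (λ z → pow z (p ℕ.^ i)) (solve 2 (λ x y → y :+ (x :+ :- y) := x) refl x y) ⟩
    pow x (p ℕ.^ i)                             ≡⟨ e ⟩
    pow y (p ℕ.^ i)                             ∎)) (pow-≢0 (p ℕ.^ i) ¬h)

  Deg-pow-shift : ∀ k → Deg k (λ t → pow (t + 1#) k) 1#
  Deg-pow-shift zero    = Deg-const 1#
  Deg-pow-shift (suc k) = Deg-ext
    (λ t → solve 2 (λ t x → t :* x :+ x := (t :+ con (ℤ.+ 1)) :* x) refl t (pow (t + 1#) k))
    (subst (Deg (suc k) _) (+-identityʳ 1#) (Deg-+ (Deg-x* (Deg-pow-shift k)) (Deg-raise (Deg-pow-shift k))))

  -- By (t+1)^(m+2) - t^(m+2) = (t+1)^(m+1) + t((t+1)^(m+1) - t^(m+1)), each step adds 1 to the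
  -- leading coefficient.
  Deg-difference : ∀ m → Deg m (λ t → pow (t + 1#) (suc m) + - pow t (suc m)) (embed (suc m))
  Deg-difference zero    t = solve 1 (λ t → (t :+ con (ℤ.+ 1)) :* con (ℤ.+ 1) :+ :- (t :* con (ℤ.+ 1))
    := con (ℤ.+ 1) :+ con (ℤ.+ 0)) refl t
  Deg-difference (suc m) = Deg-ext
    (λ t → solve 3 (λ t x y → (t :+ con (ℤ.+ 1)) :* x :+ t :* ((t :+ con (ℤ.+ 1)) :* x :+ :- y)
      := (t :+ con (ℤ.+ 1)) :* ((t :+ con (ℤ.+ 1)) :* x) :+ :- (t :* y)) refl t (pow (t + 1#) m) (pow t (suc m)))
    (Deg-+ (Deg-pow-shift (suc m)) (Deg-x* (Deg-difference m)))

  additive⇒p-power : ∀ {k} → 0 ℕ.< k → k ℕ.< size → (∀ t → pow (t + 1#) k ≡ pow t k + 1#) → ∃[ a ] k ≡ p ℕ.^ a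
  additive⇒p-power {k} 0<k k<q additive with splitPower pr k 0<k
  ... | a , zero , _ , p∤0 = contradiction (p ℕ.∣0) p∤0
  ... | a , suc zero , k≡ , _ = a , trans k≡ (ℕ.*-identityʳ _)
  -- With m at least 2 the difference has positive degree m - 1, so subtracting the constant 1
  -- leaves its leading coefficient m untouched; for m = 1 the two cancel.
  ... | a , m@(suc (suc m′)) , k≡ , p∤m = contradiction
    (trans (sym (+-identityʳ _)) (Deg-vanishing
      (Deg-+ (Deg-difference (suc m′)) (Deg-< {k = 0} (s≤s z≤n) (Deg-const (- 1#)))) 1+m′<q root))
    (embed-∤ p∤m)
    where
    1+m′<q : suc m′ ℕ.< size
    1+m′<q = ℕ.<-trans (ℕ.≤-trans (ℕ.m≤n*m m (p ℕ.^ a) {{ℕ.>-nonZero (0<p^ a)}}) (ℕ.≤-reflexive (sym k≡))) k<q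
    additive-m : ∀ t → pow (t + 1#) m ≡ pow t m + 1#
    additive-m t = frobenius^-injective a (begin
      pow (pow (t + 1#) m) (p ℕ.^ a)                   ≡⟨ pow-k (t + 1#) ⟩
      pow (t + 1#) k                                   ≡⟨ additive t ⟩
      pow t k + 1#                                     ≡⟨ cong₂ _+_ (pow-k t) (pow-1# (p ℕ.^ a)) ⟨
      pow (pow t m) (p ℕ.^ a) + pow 1# (p ℕ.^ a)       ≡⟨ frobenius^-+ a (pow t m) 1# ⟨
      pow (pow t m + 1#) (p ℕ.^ a)                     ∎)
      where
      pow-k : ∀ x → pow (pow x m) (p ℕ.^ a) ≡ pow x k
      pow-k x = trans (pow-pow x m (p ℕ.^ a)) (cong (pow x) (trans (ℕ.*-comm m (p ℕ.^ a)) (sym k≡)))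
    root : ∀ t → (pow (t + 1#) m + - pow t m) + - 1# ≡ 0#
    root t = trans (cong (λ z → (z + - pow t m) + - 1#) (additive-m t))
      (solve 1 (λ x → ((x :+ con (ℤ.+ 1)) :+ :- x) :+ :- con (ℤ.+ 1) := con (ℤ.+ 0)) refl (pow t m))

  -- The polynomial argument wants an exponent below q, so d is replaced by its residue r modulo q -
  -- 1, which defines the same power function on F.
  additive⇒degenerate : ∀ {d} → 0 ℕ.< d → gcd d (size ℕ.∸ 1) ≡ 1 →
                        (∀ t → pow (t + 1#) d ≡ pow t d + 1#) → Degenerate p size d
  additive⇒degenerate {d} 0<d coprime additive = go (size ℕ.∸ 1) refl
    where
    open PermutationExponent F d 0<d 0<size coprime
    go : ∀ m → size ℕ.∸ 1 ≡ m → Degenerate p size d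
    go zero e = contradiction (ℕ.≤-trans 1<size (ℕ.m∸n≡0⇒m≤n e)) (ℕ.<-irrefl refl)
      where
      1<size : 1 ℕ.< size
      1<size = subst (1 ℕ.<_) (sym size≡) (ℕ.^-monoʳ-< p 1<p 0<n)
    -- For q = 2 the residue would be 0, but modulo 1 every d is congruent to p^0.
    go (suc zero) e = 0 , subst (ℕ._∣ ℕ.∣ d - p ℕ.^ 0 ∣) (sym e) (ℕ.1∣ _)
    go m@(suc (suc _)) e = proj₁ power , subst (ℕ._∣ ℕ.∣ d - p ℕ.^ proj₁ power ∣) (sym e)
      (ℕ.divides (d ℕ./ m) (begin
        ℕ.∣ d - p ℕ.^ proj₁ power ∣                ≡⟨ cong₂ ℕ.∣_-_∣ (ℕ.m≡m%n+[m/n]*n d m) (sym (proj₂ power)) ⟩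
        ℕ.∣ r ℕ.+ d ℕ./ m ℕ.* m - r ∣              ≡⟨ cong (ℕ.∣ r ℕ.+ d ℕ./ m ℕ.* m -_∣) (ℕ.+-identityʳ r) ⟨
        ℕ.∣ r ℕ.+ d ℕ./ m ℕ.* m - r ℕ.+ 0 ∣        ≡⟨ ℕ.∣m+n-m+o∣≡∣n-o∣ r _ 0 ⟩
        ℕ.∣ d ℕ./ m ℕ.* m - 0 ∣                    ≡⟨ ℕ.∣-∣-identityʳ _ ⟩
        d ℕ./ m ℕ.* m                              ∎))
      where
      r = d ℕ.% m
      -- If q - 1, here at least 2, divided d, the gcd would not be 1. Positivity makes x^d and x^r
      -- agree at x = 0 as well.
      0<r : 0 ℕ.< r
      0<r = ℕ.n≢0⇒n>0 λ r≡0 → contradiction (ℕ.∣1⇒≡1 (subst (m ℕ.∣_) coprime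
        (gcd-greatest (ℕ.m%n≡0⇒n∣m d m r≡0) (subst (m ℕ.∣_) (sym e) ℕ.∣-refl)))) λ ()
      r<size : r ℕ.< size
      r<size = ℕ.<-≤-trans (ℕ.m%n<n d m) (subst (ℕ._≤ size) e (ℕ.m∸n≤m size 1))
      pow-r : ∀ x → pow x d ≡ pow x r
      pow-r x with x ≟ 0#
      ... | yes refl = trans (pow-0# 0<d) (sym (pow-0# 0<r))
      ... | no x≢0 = begin
        pow x d                              ≡⟨ cong (pow x) (ℕ.m≡m%n+[m/n]*n d m) ⟩
        pow x (r ℕ.+ d ℕ./ m ℕ.* m)          ≡⟨ pow-+ x r _ ⟩
        pow x r * pow x (d ℕ./ m ℕ.* m)      ≡⟨ cong (pow x r *_) (subst (λ m′ → pow x (d ℕ./ m ℕ.* m′) ≡ 1#) e (pow-order-* x≢0 (d ℕ./ m))) ⟩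
        pow x r * 1#                         ≡⟨ *-identityʳ _ ⟩
        pow x r                              ∎
      power : ∃[ a ] r ≡ p ℕ.^ a
      power = additive⇒p-power 0<r r<size λ t → trans (sym (pow-r (t + 1#))) (trans (additive t) (cong (_+ 1#) (pow-r t)))

-- The third moment of the sums W(a,b), over a ring with an abstract additive character

module ThirdMoment (F : FiniteField) (A : CommutativeRing 0ℓ 0ℓ) (ψ : FiniteField.Carrier F → CommutativeRing.Carrier A) where
  open FiniteField F
  open FiniteFieldProperties F hiding (solve; _:+_; _:*_; :-_; _:=_; con)
  open FiniteFieldProperties F using () renaming (solve to solveF; _:+_ to _⊹_; _:*_ to _⋆_; :-_ to ⊖_; _:=_ to _≐_; con to conF)
  open CommutativeRing A using (_≈_; semiring; commutativeSemiring)
    renaming (Carrier to C; _+_ to infixl 6 _∔_; _*_ to infixl 7 _·_; -_ to ∸_; 0# to 𝟘; 1# to 𝟙;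
              refl to ≈-refl; sym to ≈-sym; trans to ≈-trans; reflexive to ≈-reflexive;
              +-cong to ∔-cong; +-congˡ to ∔-congˡ; *-cong to ·-cong; *-congˡ to ·-congˡ; *-congʳ to ·-congʳ)
  private module A = CommutativeRing A
  open IntegerCoefficientSolver A
  open FieldSum A.+-commutativeMonoid public
  open Algebra.Properties.Semiring.Exp semiring using (_^_; ^-homo-*; ^-assocʳ; ^-congˡ)
  open Algebra.Properties.CommutativeSemiring.Exp commutativeSemiring using (^-distrib-*)
  open Algebra.Properties.Semiring.Mult semiring using () renaming (_×_ to _⨯_; ×1-homo-* to ⨯1-homo-*; ×-assoc-* to ⨯-assoc-*; ×-congʳ to ⨯-congʳ)
  module ≈-Reasoning = Relation.Binary.Reasoning.Setoid A.setoid

  *-distribˡ-∑ : ∀ a f → a · ∑ f ≈ ∑ (λ x → a · f x)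
  *-distribˡ-∑ a f = Algebra.Properties.Semiring.Sum.*-distribˡ-sum semiring a (f ∘ Inverse.to enum)

  *-distribʳ-∑ : ∀ a f → ∑ f · a ≈ ∑ (λ x → f x · a)
  *-distribʳ-∑ a f = Algebra.Properties.Semiring.Sum.*-distribʳ-sum semiring a (f ∘ Inverse.to enum)

  ∑·∑ : ∀ f g → ∑ f · ∑ g ≈ ∑ (λ x → ∑ (λ y → f x · g y))
  ∑·∑ f g = ≈-trans (*-distribʳ-∑ (∑ g) f) (∑-cong λ x → *-distribˡ-∑ (f x) g)

  ∑∑∑-swap : ∀ (H : Carrier → Carrier → Carrier → C) →
             ∑ (λ a → ∑ (λ b → ∑ (H a b))) ≈ ∑ (λ x → ∑ (λ a → ∑ (λ b → H a b x)))
  ∑∑∑-swap H = ≈-trans (∑-cong λ a → ∑-comm (H a)) (∑-comm (λ a x → ∑ (λ b → H a b x)))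

  W : ℕ → Carrier → Carrier → C
  W d a b = ∑ (λ x → ψ (b * pow x d + - (a * x)))

  module _ (ψ-+ : ∀ x y → ψ (x + y) ≈ ψ x · ψ y) (ψ-0 : ψ 0# ≈ 𝟙) (∑ψ≈0 : ∑ ψ ≈ 𝟘) where

    ∑ψ-≡0 : ∀ {y} → y ≡ 0# → ∑ (λ a → ψ (a * y)) ≈ size ⨯ 𝟙
    ∑ψ-≡0 refl = ≈-trans (∑-cong λ a → ≈-trans (≈-reflexive (cong ψ (zeroʳ a))) ψ-0) (∑-const 𝟙)

    ∑ψ-≢0 : ∀ {y} → y ≢ 0# → ∑ (λ a → ψ (a * y)) ≈ 𝟘
    ∑ψ-≢0 {y} y≢0 = ≈-trans (∑-cong λ a → ≈-reflexive (cong ψ (*-comm a y)))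
      (≈-trans (≈-sym (∑-bijection (*-bijection y y≢0) ψ)) ∑ψ≈0)

    module _ (d : ℕ) (0<d : 0 ℕ.< d) where

      -- Substituting c x for x in W(a/c, 1), with c^d = b, produces W(a, b).
      W-rescale : ∀ a {b c} (c≢0 : c ≢ 0#) → pow c d ≡ b → W d a b ≈ W d (inv c c≢0 * a) 1#
      W-rescale a {b} {c} c≢0 c^d≡b = ≈-sym (≈-trans
        (∑-bijection (*-bijection c c≢0) (λ x → ψ (1# * pow x d + - (inv c c≢0 * a * x))))
        (∑-cong λ x → ≈-reflexive (cong ψ (cong₂ (λ u v → u + - v)
          (trans (*-identityˡ _) (trans (pow-distrib-* c x d) (cong (_* pow x d) c^d≡b)))
          (trans (solveF 4 (λ i a c x → i ⋆ a ⋆ (c ⋆ x) ≐ c ⋆ i ⋆ (a ⋆ x)) refl (inv c c≢0) a c x)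
            (trans (cong (_* (a * x)) (*-inv c c≢0)) (*-identityˡ _)))))))

      private
        b≡0 : ∀ {b} a x → b ≡ 0# → b * pow x d + - (a * x) ≡ x * - a
        b≡0 a x refl = solveF 3 (λ a x y → conF (ℤ.+ 0) ⋆ y ⊹ ⊖ (a ⋆ x) ≐ x ⋆ ⊖ a) refl a x (pow x d)

      -- For b = 0 the sum is an orthogonality relation, outside the reach of rescaling to W(a'), so
      -- it is evaluated outright.
      W-00 : ∀ {a b} → a ≡ 0# → b ≡ 0# → W d a b ≈ size ⨯ 𝟙
      W-00 {a} refl b≡ = ≈-trans (∑-cong λ x → ≈-reflexive (cong ψ (b≡0 0# x b≡)))
        (∑ψ-≡0 (solveF 0 (⊖ conF (ℤ.+ 0) ≐ conF (ℤ.+ 0)) refl))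

      W-a0 : ∀ {a b} → a ≢ 0# → b ≡ 0# → W d a b ≈ 𝟘
      W-a0 {a} a≢0 b≡ = ≈-trans (∑-cong λ x → ≈-reflexive (cong ψ (b≡0 a x b≡)))
        (∑ψ-≢0 (neg-≢0 a≢0))
        where
        neg-≢0 : ∀ {a} → a ≢ 0# → - a ≢ 0#
        neg-≢0 {a} a≢0 e = a≢0 (trans (solveF 1 (λ a → a ≐ ⊖ ⊖ a) refl a) (trans (cong -_ e)
          (solveF 0 (⊖ conF (ℤ.+ 0) ≐ conF (ℤ.+ 0)) refl)))

      module _ (B C′ : Carrier) where

        -- The product of the three sums has phase b L + a M, so b and a act as dual variables for
        -- the equations L = 0 and M = 0.
        L M : Carrier → Carrier → Carrier → Carrier
        L x y z = pow x d + - (C′ * pow y d + B * pow z d)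
        M x y z = (y + z) + - x

        term : Carrier → Carrier → C
        term a b = W d a b · W d (- a) (- (C′ * b)) · W d (- a) (- (B * b))

        term-expand : ∀ a b → term a b ≈ ∑ λ x → ∑ λ y → ∑ λ z → ψ (b * L x y z) · ψ (a * M x y z)
        term-expand a b = begin
          ∑ f · ∑ g · ∑ h                                     ≈⟨ ·-congʳ (∑·∑ f g) ⟩
          ∑ (λ x → ∑ (λ y → f x · g y)) · ∑ h                 ≈⟨ *-distribʳ-∑ (∑ h) (λ x → ∑ (λ y → f x · g y)) ⟩
          ∑ (λ x → ∑ (λ y → f x · g y) · ∑ h)                 ≈⟨ ∑-cong (λ x → ∑·∑ (λ y → f x · g y) h) ⟩
          ∑ (λ x → ∑ (λ y → ∑ (λ z → f x · g y · h z)))       ≈⟨ ∑-cong (λ x → ∑-cong λ y → ∑-cong λ z → combine x y z) ⟩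
          ∑ (λ x → ∑ λ y → ∑ λ z → ψ (b * L x y z) · ψ (a * M x y z)) ∎
          where
          open ≈-Reasoning
          f g h : Carrier → C
          f x = ψ (b * pow x d + - (a * x))
          g x = ψ (- (C′ * b) * pow x d + - (- a * x))
          h x = ψ (- (B * b) * pow x d + - (- a * x))
          combine : ∀ x y z → f x · g y · h z ≈ ψ (b * L x y z) · ψ (a * M x y z)
          combine x y z = ≈-trans (·-congʳ (≈-sym (ψ-+ _ _))) (≈-trans (≈-sym (ψ-+ _ _))
            (≈-trans (≈-reflexive (cong ψ (identity a b C′ B x y z (pow x d) (pow y d) (pow z d)))) (ψ-+ _ _)))
            where
            identity : ∀ a b c e x y z u v w →
              ((b * u + - (a * x)) + (- (c * b) * v + - (- a * y))) + (- (e * b) * w + - (- a * z))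
              ≡ b * (u + - (c * v + e * w)) + a * ((y + z) + - x)
            identity = solveF 10 (λ a b c e x y z u v w →
              ((b ⋆ u ⊹ ⊖ (a ⋆ x)) ⊹ (⊖ (c ⋆ b) ⋆ v ⊹ ⊖ (⊖ a ⋆ y))) ⊹ (⊖ (e ⋆ b) ⋆ w ⊹ ⊖ (⊖ a ⋆ z))
              ≐ b ⋆ (u ⊹ ⊖ (c ⋆ v ⊹ e ⋆ w)) ⊹ a ⋆ ((y ⊹ z) ⊹ ⊖ x)) refl

        moment : ∑ (λ a → ∑ (term a)) ≈ ∑ λ x → ∑ λ y → ∑ λ z → ∑ (λ b → ψ (b * L x y z)) · ∑ (λ a → ψ (a * M x y z))
        moment = begin
          ∑ (λ a → ∑ (term a))
            ≈⟨ ∑-cong (λ a → ∑-cong λ b → term-expand a b) ⟩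
          ∑ (λ a → ∑ λ b → ∑ λ x → ∑ λ y → ∑ λ z → G a b x y z)
            ≈⟨ ∑∑∑-swap (λ a b x → ∑ λ y → ∑ λ z → G a b x y z) ⟩
          ∑ (λ x → ∑ λ a → ∑ λ b → ∑ λ y → ∑ λ z → G a b x y z)
            ≈⟨ ∑-cong (λ x → ∑∑∑-swap (λ a b y → ∑ λ z → G a b x y z)) ⟩
          ∑ (λ x → ∑ λ y → ∑ λ a → ∑ λ b → ∑ λ z → G a b x y z)
            ≈⟨ ∑-cong (λ x → ∑-cong λ y → ∑∑∑-swap (λ a b z → G a b x y z)) ⟩
          ∑ (λ x → ∑ λ y → ∑ λ z → ∑ λ a → ∑ λ b → G a b x y z)
            ≈⟨ ∑-cong (λ x → ∑-cong λ y → ∑-cong λ z → ≈-trans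
                 (∑-comm (λ a b → G a b x y z))
                 (≈-sym (∑·∑ (λ b → ψ (b * L x y z)) (λ a → ψ (a * M x y z))))) ⟩
          ∑ (λ x → ∑ λ y → ∑ λ z → ∑ (λ b → ψ (b * L x y z)) · ∑ (λ a → ψ (a * M x y z))) ∎
          where
          open ≈-Reasoning
          G : Carrier → Carrier → Carrier → Carrier → Carrier → C
          G a b x y z = ψ (b * L x y z) · ψ (a * M x y z)

        -- For z ≠ 0, homogeneity lets t = y/z solve the excluded equation. For z = 0 what remains
        -- is x = y and (1 - C)x^d = 0, where C ≠ 1 enters.
        trivial-zero : C′ ≢ 1# → (∀ t → pow (t + 1#) d ≢ C′ * pow t d + B) →
                       ∀ x y z → L x y z ≡ 0# → M x y z ≡ 0# → x ≡ 0# × y ≡ 0# × z ≡ 0#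
        trivial-zero C≢1 none x y z L≡0 M≡0 with z ≟ 0#
        ... | no z≢0 = contradiction (*-cancelˡ (pow-≢0 d z≢0) scaled) (none t)
          where
          open ≡-Reasoning
          t = inv z z≢0 * y
          zt : z * t ≡ y
          zt = trans (sym (*-assoc z _ y)) (trans (cong (_* y) (*-inv z z≢0)) (*-identityˡ y))
          scaled : pow z d * pow (t + 1#) d ≡ pow z d * (C′ * pow t d + B)
          scaled = begin
            pow z d * pow (t + 1#) d              ≡⟨ pow-distrib-* z (t + 1#) d ⟨
            pow (z * (t + 1#)) d                  ≡⟨ cong (λ w → pow w d) (trans (solveF 2 (λ z t → z ⋆ (t ⊹ conF (ℤ.+ 1)) ≐ z ⋆ t ⊹ z) refl z t)
                                                       (trans (cong (_+ z) zt) (x-y≡0⇒x≡y M≡0))) ⟩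
            pow x d                               ≡⟨ x-y≡0⇒x≡y L≡0 ⟩
            C′ * pow y d + B * pow z d            ≡⟨ cong (λ w → C′ * w + B * pow z d) (trans (cong (λ w → pow w d) (sym zt)) (pow-distrib-* z t d)) ⟩
            C′ * (pow z d * pow t d) + B * pow z d
              ≡⟨ solveF 4 (λ c u v b → c ⋆ (u ⋆ v) ⊹ b ⋆ u ≐ u ⋆ (c ⋆ v ⊹ b)) refl C′ (pow z d) (pow t d) B ⟩
            pow z d * (C′ * pow t d + B)          ∎
        ... | yes refl = x≡0 , trans y≡x x≡0 , refl
          where
          y≡x : y ≡ x
          y≡x = trans (sym (+-identityʳ y)) (x-y≡0⇒x≡y M≡0)
          x^d[1-C]≡0 : (1# + - C′) * pow x d ≡ 0#
          x^d[1-C]≡0 = trans (solveF 3 (λ c x b → (conF (ℤ.+ 1) ⊹ ⊖ c) ⋆ x ≐ x ⊹ ⊖ (c ⋆ x ⊹ b ⋆ conF (ℤ.+ 0))) refl C′ (pow x d) B)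
            (trans (cong₂ (λ u v → pow x d + - (C′ * pow u d + B * v)) (sym y≡x) (sym (pow-0# 0<d))) L≡0)
          x≡0 : x ≡ 0#
          x≡0 with x ≟ 0#
          ... | yes e = e
          ... | no x≢0 = contradiction (*≡0⇒≡0 (λ e → C≢1 (sym (x-y≡0⇒x≡y e))) x^d[1-C]≡0) (pow-≢0 d x≢0)

        -- Orthogonality kills every triple outside the common zeros of L and M, so the origin alone
        -- contributes, with a factor q from each of the sums over a and b.
        moment-trivial : C′ ≢ 1# → (∀ t → pow (t + 1#) d ≢ C′ * pow t d + B) →
                         ∑ (λ a → ∑ (term a)) ≈ (size ⨯ 𝟙) · (size ⨯ 𝟙)
        moment-trivial C≢1 none = begin
          ∑ (λ a → ∑ (term a))              ≈⟨ moment ⟩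
          ∑ (λ x → ∑ λ y → ∑ (G x y))       ≈⟨ ∑-single (λ x → ∑ λ y → ∑ (G x y)) 0# (λ x x≢0 → vanish₂ x λ y z → x≢0 ∘ proj₁ ) ⟩
          ∑ (λ y → ∑ (G 0# y))              ≈⟨ ∑-single (λ y → ∑ (G 0# y)) 0# (λ y y≢0 → vanish₁ 0# y λ z → y≢0 ∘ proj₁ ∘ proj₂) ⟩
          ∑ (G 0# 0#)                       ≈⟨ ∑-single (G 0# 0#) 0# (λ z z≢0 → vanish 0# 0# z (z≢0 ∘ proj₂ ∘ proj₂)) ⟩
          G 0# 0# 0#                        ≈⟨ ·-cong (∑ψ-≡0 L000) (∑ψ-≡0 M000) ⟩
          (size ⨯ 𝟙) · (size ⨯ 𝟙)           ∎
          where
          open ≈-Reasoning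
          G : Carrier → Carrier → Carrier → C
          G x y z = ∑ (λ b → ψ (b * L x y z)) · ∑ (λ a → ψ (a * M x y z))
          L000 : L 0# 0# 0# ≡ 0#
          L000 rewrite pow-0# 0<d = solveF 2 (λ c b → conF (ℤ.+ 0) ⊹ ⊖ (c ⋆ conF (ℤ.+ 0) ⊹ b ⋆ conF (ℤ.+ 0)) ≐ conF (ℤ.+ 0)) refl C′ B
          M000 : M 0# 0# 0# ≡ 0#
          M000 = solveF 0 (conF (ℤ.+ 0) ⊹ conF (ℤ.+ 0) ⊹ ⊖ conF (ℤ.+ 0) ≐ conF (ℤ.+ 0)) refl
          ∑-zero : ∀ f → (∀ x → f x ≈ 𝟘) → ∑ f ≈ 𝟘
          ∑-zero f h = ≈-trans (∑-single f 0# λ x _ → h x) (h 0#)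
          vanish : ∀ x y z → ¬ (x ≡ 0# × y ≡ 0# × z ≡ 0#) → G x y z ≈ 𝟘
          vanish x y z ¬0 with L x y z ≟ 0# | M x y z ≟ 0#
          ... | yes L≡0 | yes M≡0 = contradiction (trivial-zero C≢1 none x y z L≡0 M≡0) ¬0
          ... | no L≢0  | _       = ≈-trans (·-congʳ (∑ψ-≢0 L≢0)) (A.zeroˡ _)
          ... | yes _   | no M≢0  = ≈-trans (·-congˡ (∑ψ-≢0 M≢0)) (A.zeroʳ _)
          vanish₁ : ∀ x y → (∀ z → ¬ (x ≡ 0# × y ≡ 0# × z ≡ 0#)) → ∑ (G x y) ≈ 𝟘
          vanish₁ x y ¬0 = ∑-zero (G x y) λ z → vanish x y z (¬0 z)
          vanish₂ : ∀ x → (∀ y z → ¬ (x ≡ 0# × y ≡ 0# × z ≡ 0#)) → ∑ (λ y → ∑ (G x y)) ≈ 𝟘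
          vanish₂ x ¬0 = ∑-zero (λ y → ∑ (G x y)) λ y → vanish₁ x y (¬0 y)

      module _ (p-1 n : ℕ) (size≡ : size ≡ suc p-1 ℕ.^ suc n) (π v : C)
               (torsionFree : ∀ m {f} → (suc p-1 ℕ.^ m) ⨯ f ≈ 𝟘 → f ≈ 𝟘)
               (π^[p-1] : π ^ p-1 ≈ suc p-1 ⨯ v)
               (1∉⟨π,p⟩ : ∀ g h → ¬ 𝟙 ≈ π · g ∔ suc p-1 ⨯ h)
               (K e : ℕ) (3K≡ : K ℕ.+ K ℕ.+ K ≡ p-1 ℕ.* (suc n ℕ.+ suc n) ℕ.+ suc e)
               (divisible : ∀ a → ∃[ g ] W d a 1# ≈ π ^ K · g)
               (root : ∀ a → ∃[ r ] pow r d ≡ a) where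

        private
          p : ℕ
          p = suc p-1

          P Q : C
          P = p ⨯ 𝟙
          Q = P ^ suc n

          ⨯≈· : ∀ k x → k ⨯ x ≈ (k ⨯ 𝟙) · x
          ⨯≈· k x = ≈-sym (≈-trans (⨯-assoc-* k 𝟙 x) (⨯-congʳ k (A.*-identityˡ x)))

          p^⨯ : ∀ k → (p ℕ.^ k) ⨯ 𝟙 ≈ P ^ k
          p^⨯ zero    = A.+-identityʳ 𝟙
          p^⨯ (suc k) = ≈-trans (⨯1-homo-* p (p ℕ.^ k)) (·-congˡ (p^⨯ k))

          size⨯ : size ⨯ 𝟙 ≈ Q
          size⨯ = ≈-trans (≈-reflexive (cong (_⨯ 𝟙) size≡)) (p^⨯ (suc n))

          -- The ideal q²(π, p).
          _∈J : C → Set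
          z ∈J = ∃₂ λ g h → z ≈ Q · Q · (π · g ∔ P · h)

          0∈J : ∀ {z} → z ≈ 𝟘 → z ∈J
          0∈J z≈0 = 𝟘 , 𝟘 , ≈-trans z≈0 (solve 3 (λ q π p → con (ℤ.+ 0)
            := q :* q :* (π :* con (ℤ.+ 0) :+ p :* con (ℤ.+ 0))) ≈-refl Q π P)

          +-∈J : ∀ {y z} → y ∈J → z ∈J → (y ∔ z) ∈J
          +-∈J (g , h , e) (g′ , h′ , e′) = g ∔ g′ , h ∔ h′ , ≈-trans (∔-cong e e′)
            (solve 7 (λ q π p g h g′ h′ → q :* q :* (π :* g :+ p :* h) :+ q :* q :* (π :* g′ :+ p :* h′)
              := q :* q :* (π :* (g :+ g′) :+ p :* (h :+ h′))) ≈-refl Q π P g h g′ h′)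

          ∑-∈J : ∀ f → (∀ x → f x ∈J) → ∑ f ∈J
          ∑-∈J f h = go (λ i → f (Inverse.to enum i)) (h ∘ Inverse.to enum)
            where
            open Algebra.Properties.Semiring.Sum semiring using (sum)
            go : ∀ {k} (t : Fin k → C) → (∀ i → t i ∈J) → sum t ∈J
            go {zero}  t h = 0∈J ≈-refl
            go {suc k} t h = +-∈J (h zero) (go (t ∘ suc) (h ∘ suc))

          -- In 3K = (p-1)N + e + 1, with N twice the degree of F, the first part yields p^N = q²,
          -- and the surplus e + 1, being at least 1, leaves a factor π.
          π^3K : ∃[ u ] π ^ K · π ^ K · π ^ K ≈ Q · Q · (π · u)
          π^3K = v ^ N · π ^ e , (begin
            π ^ K · π ^ K · π ^ K                  ≈⟨ ·-congʳ (^-homo-* π K K) ⟨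
            π ^ (K ℕ.+ K) · π ^ K                  ≈⟨ ^-homo-* π (K ℕ.+ K) K ⟨
            π ^ (K ℕ.+ K ℕ.+ K)                    ≡⟨ cong (π ^_) 3K≡ ⟩
            π ^ (p-1 ℕ.* N ℕ.+ suc e)              ≈⟨ ^-homo-* π (p-1 ℕ.* N) (suc e) ⟩
            π ^ (p-1 ℕ.* N) · (π · π ^ e)          ≈⟨ ·-congʳ (^-assocʳ π p-1 N) ⟨
            (π ^ p-1) ^ N · (π · π ^ e)            ≈⟨ ·-congʳ (^-congˡ N (≈-trans π^[p-1] (⨯≈· p v))) ⟩
            (P · v) ^ N · (π · π ^ e)              ≈⟨ ·-congʳ (^-distrib-* P v N) ⟩
            P ^ N · v ^ N · (π · π ^ e)            ≈⟨ ·-congʳ (·-congʳ (^-homo-* P (suc n) (suc n))) ⟩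
            Q · Q · v ^ N · (π · π ^ e)            ≈⟨ regroup Q (v ^ N) π (π ^ e) ⟩
            Q · Q · (π · (v ^ N · π ^ e))          ∎)
            where
            open ≈-Reasoning
            N = suc n ℕ.+ suc n
            regroup : ∀ q w π y → q · q · w · (π · y) ≈ q · q · (π · (w · y))
            regroup = solve 4 (λ q w π y → q :* q :* w :* (π :* y) := q :* q :* (π :* (w :* y))) ≈-refl

          divisible-≢0 : ∀ a {b} → b ≢ 0# → ∃[ g ] W d a b ≈ π ^ K · g
          divisible-≢0 a {b} b≢0 = proj₁ (divisible a′) ,
            ≈-trans (W-rescale a c≢0 (proj₂ (root b))) (proj₂ (divisible a′))
            where
            c = proj₁ (root b)
            c≢0 : c ≢ 0#
            c≢0 c≡0 = b≢0 (trans (sym (proj₂ (root b))) (trans (cong (λ z → pow z d) c≡0) (pow-0# 0<d)))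
            a′ = inv c c≢0 * a

          neg*-≡0 : ∀ x {b} → b ≡ 0# → - (x * b) ≡ 0#
          neg*-≡0 x refl = solveF 1 (λ x → ⊖ (x ⋆ conF (ℤ.+ 0)) ≐ conF (ℤ.+ 0)) refl x

          neg*-≢0 : ∀ {x b} → x ≢ 0# → b ≢ 0# → - (x * b) ≢ 0#
          neg*-≢0 {x} {b} x≢0 b≢0 e = *-≢0 x≢0 b≢0 (trans (solveF 2 (λ x b → x ⋆ b ≐ conF (ℤ.+ 0) ⊹ ⊖ ⊖ (x ⋆ b)) refl x b)
            (trans (cong (λ z → 0# + - z) e) (-‿inverseʳ 0#)))

          Q³≈ : Q · Q · Q ≈ Q · Q · (π · 𝟘 ∔ P · P ^ n)
          Q³≈ = solve 4 (λ q π p y → q :* q :* (p :* y) := q :* q :* (π :* con (ℤ.+ 0) :+ p :* y)) ≈-refl Q π P (P ^ n)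

          cube : ∀ x g g′ g″ → (x · g) · (x · g′) · (x · g″) ≈ (x · x · x) · (g · g′ · g″)
          cube = solve 4 (λ x g g′ g″ → (x :* g) :* (x :* g′) :* (x :* g″) := (x :* x :* x) :* (g :* g′ :* g″)) ≈-refl

          regroup : ∀ q π u w p → q · q · (π · u) · w ≈ q · q · (π · (u · w) ∔ p · 𝟘)
          regroup = solve 5 (λ q π u w p → q :* q :* (π :* u) :* w := q :* q :* (π :* (u :* w) :+ p :* con (ℤ.+ 0))) ≈-refl

          -- If b ≠ 0, all three second arguments are nonzero because B and C are, and each factor
          -- contributes π^K. If b = 0, the first factor vanishes unless a = 0 too.
          term-∈J : ∀ {B C′} → B ≢ 0# → C′ ≢ 0# → ∀ a b → term B C′ a b ∈J
          term-∈J {B} {C′} B≢0 C≢0 a b with b ≟ 0#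
          ... | no b≢0 = proj₁ π^3K · G , 𝟘 , ≈-trans (·-cong (·-cong (proj₂ D₁) (proj₂ D₂)) (proj₂ D₃))
            (≈-trans (cube (π ^ K) (proj₁ D₁) (proj₁ D₂) (proj₁ D₃))
              (≈-trans (·-congʳ (proj₂ π^3K)) (regroup Q π (proj₁ π^3K) G P)))
            where
            D₁ = divisible-≢0 a b≢0
            D₂ = divisible-≢0 (- a) (neg*-≢0 C≢0 b≢0)
            D₃ = divisible-≢0 (- a) (neg*-≢0 B≢0 b≢0)
            G = proj₁ D₁ · proj₁ D₂ · proj₁ D₃
          ... | yes b≡0 with a ≟ 0#
          ... | no a≢0 = 0∈J (≈-trans (·-congʳ (≈-trans (·-congʳ (W-a0 a≢0 b≡0)) (A.zeroˡ _))) (A.zeroˡ _))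
          -- At a = b = 0 the term is q³ = q² · p · p^n, the degree n + 1 being positive; it
          -- accounts for the generator p of the ideal.
          ... | yes refl = 𝟘 , P ^ n , ≈-trans (·-cong (·-cong (W≈Q refl b≡0)
              (W≈Q -0≡0 (neg*-≡0 C′ b≡0))) (W≈Q -0≡0 (neg*-≡0 B b≡0))) Q³≈
            where
            W≈Q : ∀ {a b} → a ≡ 0# → b ≡ 0# → W d a b ≈ Q
            W≈Q a≡0 b≡0 = ≈-trans (W-00 a≡0 b≡0) size⨯
            -0≡0 : - 0# ≡ 0#
            -0≡0 = solveF 0 (⊖ conF (ℤ.+ 0) ≐ conF (ℤ.+ 0)) refl

          -- Torsion-freeness cancels q², a power of p, from the membership equation and leaves 1 in
          -- (π, p).
          Q²∉J : ¬ (Q · Q) ∈J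
          Q²∉J (g , h , e) = 1∉⟨π,p⟩ g h (≈-trans 1≈ (∔-congˡ (≈-sym (⨯≈· p h))))
            where
            D = 𝟙 ∔ ∸ (π · g ∔ P · h)
            killed : (p ℕ.^ (suc n ℕ.+ suc n)) ⨯ D ≈ 𝟘
            killed = begin
              (p ℕ.^ (suc n ℕ.+ suc n)) ⨯ D            ≈⟨ ⨯≈· (p ℕ.^ (suc n ℕ.+ suc n)) D ⟩
              (p ℕ.^ (suc n ℕ.+ suc n)) ⨯ 𝟙 · D        ≈⟨ ·-congʳ (≈-trans (p^⨯ (suc n ℕ.+ suc n)) (^-homo-* P (suc n) (suc n))) ⟩
              Q · Q · D                                ≈⟨ solve 2 (λ q y → q :* q :* (con (ℤ.+ 1) :+ :- y) := q :* q :+ :- (q :* q :* y)) ≈-refl Q (π · g ∔ P · h) ⟩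
              Q · Q ∔ ∸ (Q · Q · (π · g ∔ P · h))      ≈⟨ ∔-congˡ (A.-‿cong e) ⟨
              Q · Q ∔ ∸ (Q · Q)                        ≈⟨ A.-‿inverseʳ (Q · Q) ⟩
              𝟘                                        ∎
              where open ≈-Reasoning
            1≈ : 𝟙 ≈ π · g ∔ P · h
            1≈ = ≈-trans (solve 1 (λ y → con (ℤ.+ 1) := (con (ℤ.+ 1) :+ :- y) :+ y) ≈-refl (π · g ∔ P · h))
              (≈-trans (A.+-congʳ (torsionFree (suc n ℕ.+ suc n) killed)) (A.+-identityˡ _))

        solvable : ∀ B C′ → B ≢ 0# → C′ ≢ 0# → C′ ≢ 1# → ∃[ t ] pow (t + 1#) d ≡ C′ * pow t d + B
        solvable B C′ B≢0 C≢0 C≢1 with ∃? (λ t → pow (t + 1#) d ≟ (C′ * pow t d + B))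
        ... | yes h = h
        ... | no ¬∃ = contradiction Q²∈J Q²∉J
          where
          Q²∈J : (Q · Q) ∈J
          Q²∈J with ∑-∈J (λ a → ∑ (term B C′ a)) (λ a → ∑-∈J (term B C′ a) (term-∈J B≢0 C≢0 a))
          ... | g , h , e = g , h , ≈-trans (≈-sym (≈-trans (moment-trivial B C′ C≢1 (λ t h → ¬∃ (t , h))) (·-cong size⨯ size⨯))) e

-- Coefficient lists and monomials

module _ where
  open IntegerPolynomials
  private module P = CommutativeRing ℤ[X]
  open Algebra.Properties.Semiring.Exp P.semiring using (_^_)

  δ : ∀ {p} → Fin p → Fin p → ℤ.ℤ
  δ k i = if does (i Fin.≟ k) then ℤ.1ℤ else ℤ.0ℤ

  tabulate-0 : ∀ p → tabulate {n = p} (λ _ → ℤ.0ℤ) ≃ []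
  tabulate-0 zero    = ≃-refl
  tabulate-0 (suc p) = ≃-trans (∷-cong refl (tabulate-0 p)) 0∷[]

  δ-suc : ∀ {p} (k i : Fin p) → δ (suc k) (suc i) ≡ δ k i
  δ-suc k i with i Fin.≟ k
  ... | yes _ = refl
  ... | no  _ = refl

  tabulate-δ : ∀ {p} (k : Fin p) → tabulate (δ k) ≃ X ^ toℕ k
  tabulate-δ {suc p} zero    = ∷-cong refl (tabulate-0 p)
  tabulate-δ {suc p} (suc k) = ≃-trans (∷-cong refl (≃-trans
    (mk λ i → cong (λ f → coeff f i) (tabulate-cong (δ-suc k))) (tabulate-δ k))) (≃-sym (X-* (X ^ toℕ k)))

  tabulate-padd : ∀ {p} (f g : Fin p → ℤ.ℤ) → tabulate (λ i → f i ℤ.+ g i) ≡ padd (tabulate f) (tabulate g)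
  tabulate-padd {zero}  f g = refl
  tabulate-padd {suc p} f g = cong (f zero ℤ.+ g zero ∷_) (tabulate-padd (f ∘ suc) (g ∘ suc))

-- The character ψ(x) = ζ^(Tr x)

module TraceCharacter (F : FiniteField) (p n : ℕ) (pr : Prime p)
  (char : FiniteField.embed F p ≡ FiniteField.0# F) (size≡ : FiniteField.size F ≡ p ℕ.^ n)
  (A : CommutativeRing 0ℓ 0ℓ) (ζ : CommutativeRing.Carrier A) where
  open FiniteField F
  open FiniteFieldProperties F using (+-bijection; +-identityˡ; embed-1; x+y≡x⇒y≡0; module FieldSum)
  open CharacteristicP F p n pr char size≡
  private module A = CommutativeRing A
  open A using (_≈_) renaming (_*_ to infixl 7 _·_)
  open Algebra.Properties.Semiring.Exp A.semiring using () renaming (_^_ to infixr 8 _^ᴬ_; ^-homo-* to ^ᴬ-homo)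
  open FieldSum A.+-commutativeMonoid

  ψ : Carrier → A.Carrier
  ψ x = ζ ^ᴬ res x

  module _ (ζ^p≈1 : ζ ^ᴬ p ≈ A.1#) where

    -- Exponents of ζ matter modulo p only, and `embed` separates the residues modulo p. This makes
    -- ψ multiplicative although the representative `res` is not additive.
    ζ^-embed : ∀ {a b} → embed a ≡ embed b → ζ ^ᴬ a ≈ ζ ^ᴬ b
    ζ^-embed {a} {b} e = A.trans (^-periodic A ζ^p≈1 a) (A.trans (A.reflexive (cong (ζ ^ᴬ_) a%p≡b%p))
      (A.sym (^-periodic A ζ^p≈1 b)))
      where
      a%p≡b%p : a ℕ.% p ≡ b ℕ.% p
      a%p≡b%p = embed-injective (ℕ.m%n<n a p) (ℕ.m%n<n b p) (trans (embed-% a) (trans e (sym (embed-% b))))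

    ψ-+ : ∀ x y → ψ (x + y) ≈ ψ x · ψ y
    ψ-+ x y = A.trans (ζ^-embed {res (x + y)} {res x ℕ.+ res y} (res-+ x y)) (^ᴬ-homo ζ (res x) (res y))

    ψ-0 : ψ 0# ≈ A.1#
    ψ-0 = ζ^-embed {res 0#} {0} (trans (embed-res 0#)
      (x+y≡x⇒y≡0 (trans (sym (trace-+ n 0# 0#)) (cong Tr (+-identityˡ 0#)))))

    -- Translating the sum by u with Tr u = 1 multiplies it by ψ(u) = ζ, so ζ fixes it.
    ∑ψ≈0 : (∀ s → ζ · s ≈ s → s ≈ A.0#) → ∑ ψ ≈ A.0#
    ∑ψ≈0 invariant⇒0 = invariant⇒0 (∑ ψ) (begin
      ζ · ∑ ψ                ≈⟨ A.*-congʳ ζ≈ψu ⟩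
      ψ u · ∑ ψ              ≈⟨ Algebra.Properties.Semiring.Sum.*-distribˡ-sum A.semiring (ψ u) (ψ ∘ Inverse.to enum) ⟩
      ∑ (λ x → ψ u · ψ x)    ≈⟨ ∑-cong (λ x → ψ-+ u x) ⟨
      ∑ (λ x → ψ (u + x))    ≈⟨ ∑-bijection (+-bijection u) ψ ⟨
      ∑ ψ                    ∎)
      where
      open Relation.Binary.Reasoning.Setoid A.setoid
      u = proj₁ trace-one
      ζ≈ψu : ζ ≈ ψ u
      ζ≈ψu = A.trans (A.sym (A.*-identityʳ ζ))
        (ζ^-embed {1} {res u} (trans embed-1 (sym (trans (embed-res u) (proj₂ trace-one)))))

-- Weil sums as sums of ψ in Z[ζ]

module WeilSum (F : FiniteField) (p-1 n : ℕ) (pr : Prime (suc p-1))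
  (char : FiniteField.embed F (suc p-1) ≡ FiniteField.0# F) (size≡ : FiniteField.size F ≡ suc p-1 ℕ.^ n) where
  open FiniteField F
  open FiniteFieldProperties F using (*-identityˡ; module FieldSum)
  open CharacteristicP F (suc p-1) n pr char size≡
  open IntegerPolynomials
  open CyclotomicIntegers p-1 pr
  private
    p : ℕ
    p = suc p-1

    module A = CommutativeRing ℤ[ζ]
    module P^ = Algebra.Properties.Semiring.Exp (CommutativeRing.semiring ℤ[X])
  open Algebra.Properties.Semiring.Exp A.semiring using (_^_)
  open FieldSum A.+-commutativeMonoid

  ψ : Carrier → Poly
  ψ = TraceCharacter.ψ F p n pr char size≡ ℤ[ζ] X

  W : ℕ → Carrier → Carrier → Poly
  W = ThirdMoment.W F ℤ[ζ] ψ

  module _ (g : Carrier → Carrier) where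

    count : List Carrier → Fin p → ℕ
    count xs m = length (filter (λ x → Tr (g x) ≟ embed (toℕ m)) xs)

    res-Fin : Carrier → Fin p
    res-Fin x = Fin.fromℕ< (res<p (g x))

    -- x is counted at its own residue and, as `embed` is injective below p, at no other.
    count-∷ : ∀ x xs m → ℤ.+ count (x ∷ xs) m ≡ δ (res-Fin x) m ℤ.+ ℤ.+ count xs m
    count-∷ x xs m with Tr (g x) ≟ embed (toℕ m) | m Fin.≟ res-Fin x
    ... | yes _ | yes _ = refl
    ... | no  _ | no  _ = sym (ℤ.+-identityˡ _)
    ... | yes e | no m≢ = contradiction (Fin.toℕ-injective (embed-injective (Fin.toℕ<n m) (Fin.toℕ<n (res-Fin x))
      (trans (sym e) (trans (sym (embed-res (g x))) (cong embed (sym (Fin.toℕ-fromℕ< (res<p (g x)))))))) ) m≢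
    ... | no ¬e | yes refl = contradiction (trans (sym (embed-res (g x)))
      (cong embed (sym (Fin.toℕ-fromℕ< (res<p (g x)))))) ¬e

    countPoly : List Carrier → Poly
    countPoly xs = tabulate (λ m → ℤ.+ count xs m)

    countPoly-∷ : ∀ x xs → countPoly (x ∷ xs) ~ padd (ψ (g x)) (countPoly xs)
    countPoly-∷ x xs = ≈⇒~ ℤ[X] (cyclotomic p) (≃-trans
      (mk λ i → cong (λ f → coeff f i) (trans (tabulate-cong (count-∷ x xs)) (tabulate-padd (δ (res-Fin x)) (λ m → ℤ.+ count xs m))))
      (padd-cong (subst (tabulate (δ (res-Fin x)) ≃_) X^≡ (tabulate-δ (res-Fin x))) (≃-refl {countPoly xs})))
      where
      X^≡ : X P^.^ toℕ (res-Fin x) ≡ ψ (g x)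
      X^≡ = trans (sym (^≡ X (toℕ (res-Fin x)))) (cong (X ^_) (Fin.toℕ-fromℕ< (res<p (g x))))

    countPoly-tabulate : ∀ {k} (h : Fin k → Carrier) →
      countPoly (tabulate h) ~ Algebra.Properties.Semiring.Sum.sum A.semiring (λ i → ψ (g (h i)))
    countPoly-tabulate {zero}  h = ≈⇒~ ℤ[X] (cyclotomic p) (tabulate-0 p)
    countPoly-tabulate {suc k} h = A.trans {countPoly (tabulate h)} {padd (ψ (g (h zero))) (countPoly (tabulate (h ∘ suc)))}
      (countPoly-∷ (h zero) (tabulate (h ∘ suc))) (A.+-congˡ {ψ (g (h zero))} (countPoly-tabulate (h ∘ suc)))

  -- `weilSum` groups the terms ψ(x^d - a x) by their trace; adding the elements of F one at a time,
  -- each brings in one monomial.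
  weilSum~W : ∀ d a → weilSum F p n d a ~ W d a 1#
  weilSum~W d a = subst (_~ W d a 1#) (sym weilSum≡) (A.trans {countPoly g (tabulate (Inverse.to enum))} {∑ (ψ ∘ g)}
    (countPoly-tabulate g (Inverse.to enum))
    (∑-cong λ x → A.reflexive (cong (λ y → ψ (y + - (a * x))) (sym (*-identityˡ (pow x d))))))
    where
    g : Carrier → Carrier
    g x = pow x d + - (a * x)
    weilSum≡ : weilSum F p n d a ≡ countPoly g (tabulate (Inverse.to enum))
    weilSum≡ = trans (map-tabulate {n = p} (λ i → i) (λ m → ℤ.+ count g elements m))
      (cong (countPoly g) (map-tabulate (λ i → i) (Inverse.to enum)))

-- K is the least integer with 3K > M. With r the remainder of M modulo 3 the surplus is 3 - r, so e
-- = 2 - r.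
threshold : ∀ M → ∃[ e ] (let K = suc (M ℕ./ 3) in K ℕ.+ K ℕ.+ K ≡ M ℕ.+ suc e)
threshold M with ℕ.m≤n⇒∃[o]m+o≡n (ℕ.≤-pred (ℕ.m%n<n M 3))
... | e , r+e≡2 = e , (begin
  K ℕ.+ K ℕ.+ K                          ≡⟨ solve 1 (λ t → (con 1 :+ t) :+ (con 1 :+ t) :+ (con 1 :+ t) := t :* con 3 :+ con 1 :+ con 2) refl t ⟩
  t ℕ.* 3 ℕ.+ 1 ℕ.+ 2                    ≡⟨ cong (t ℕ.* 3 ℕ.+ 1 ℕ.+_) r+e≡2 ⟨
  t ℕ.* 3 ℕ.+ 1 ℕ.+ (M ℕ.% 3 ℕ.+ e)      ≡⟨ solve 3 (λ t r e → t :+ con 1 :+ (r :+ e) := r :+ t :+ (con 1 :+ e)) refl (t ℕ.* 3) (M ℕ.% 3) e ⟩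
  M ℕ.% 3 ℕ.+ t ℕ.* 3 ℕ.+ suc e          ≡⟨ cong (ℕ._+ suc e) (ℕ.m≡m%n+[m/n]*n M 3) ⟨
  M ℕ.+ suc e                            ∎)
  where
  open ≡-Reasoning
  open +-*-Solver
  t = M ℕ./ 3
  K = suc t

-- Divisibility of all Weil sums forces degeneracy; the theorem

allDivisible⇒degenerate : (F : FiniteField) (p-1 n d : ℕ) → Prime (suc p-1) →
    FiniteField.embed F (suc p-1) ≡ FiniteField.0# F →
    FiniteField.size F ≡ suc p-1 ℕ.^ suc n →
    0 ℕ.< d → gcd d (FiniteField.size F ℕ.∸ 1) ≡ 1 →
    (∀ a → PiPowDivides (suc p-1) (suc ((2 ℕ.* suc n ℕ.* p-1) ℕ./ 3)) (weilSum F (suc p-1) (suc n) d a)) →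
    Degenerate (suc p-1) (FiniteField.size F) d
allDivisible⇒degenerate F p-1 n d pr char size≡ 0<d coprime allDivisible =
  additive⇒degenerate 0<d coprime (pow-d-additive
    (ThirdMoment.solvable F ℤ[ζ] ψ
      (TraceCharacter.ψ-+ F (suc p-1) (suc n) pr char size≡ ℤ[ζ] X ζ^p~1)
      (TraceCharacter.ψ-0 F (suc p-1) (suc n) pr char size≡ ℤ[ζ] X ζ^p~1)
      (TraceCharacter.∑ψ≈0 F (suc p-1) (suc n) pr char size≡ ℤ[ζ] X ζ^p~1 (λ s → X*s~s⇒s~0 {s}))
      d 0<d p-1 n size≡ π (proj₁ π^[p-1])
      (λ m {f} h → ×^-torsionFree m (subst (_~ []) (×≡ (suc p-1 ℕ.^ m) f) h))
      (subst₂ _~_ (sym (^≡ π p-1)) (sym (×≡ (suc p-1) (proj₁ π^[p-1]))) (proj₂ π^[p-1]))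
      (λ g h e → 1∉⟨π,p⟩ g h (subst (λ z → (ℤ.1ℤ ∷ []) ~ padd (pmul π g) z) (×≡ (suc p-1) h) e))
      K (proj₁ (threshold M)) 3K≡ divisible root))
  where
  open FiniteField F using (1#)
  open IntegerPolynomials using (X)
  open CyclotomicIntegers p-1 pr
  open WeilSum F p-1 (suc n) pr char size≡
  open CharacteristicP F (suc p-1) (suc n) pr char size≡ using (0<size)
  open PermutationExponent F d 0<d 0<size coprime
  open AdditivePower F (suc p-1) (suc n) pr char size≡
  module A = CommutativeRing ℤ[ζ]
  open Algebra.Properties.Semiring.Exp A.semiring using () renaming (_^_ to _^ζ_)

  M K : ℕ
  M = 2 ℕ.* suc n ℕ.* p-1
  K = suc (M ℕ./ 3)

  divisible : ∀ a → ∃[ g ] W d a 1# ~ pmul (π ^ζ K) g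
  divisible a = proj₁ q , A.trans {W d a 1#} {w} (A.sym {w} (weilSum~W d a))
    (subst (λ z → w ~ pmul z (proj₁ q)) (sym (^≡ π K)) (proj₂ q))
    where
    w = weilSum F (suc p-1) (suc n) d a
    q = PiPowDivides⇒ K {w} (allDivisible a)

  3K≡ : K ℕ.+ K ℕ.+ K ≡ p-1 ℕ.* (suc n ℕ.+ suc n) ℕ.+ suc (proj₁ (threshold M))
  3K≡ = trans (proj₂ (threshold M)) (cong (ℕ._+ suc (proj₁ (threshold M)))
    (solve 2 (λ n p → con 2 :* n :* p := p :* (n :+ n)) refl (suc n) p-1))
    where open +-*-Solver

  ζ^p~1 = subst (_~ (ℤ.1ℤ ∷ [])) (sym (^≡ X (suc p-1))) X^p~1

open import Data.Nat using (_*_; _∸_; _^_; _<_; _/_)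

theorem3p1 : (F : FiniteField) (p n d : ℕ) →
    Prime p →
    FiniteField.embed F p ≡ FiniteField.0# F →
    FiniteField.size F ≡ p ^ n →
    0 < d →
    gcd d (FiniteField.size F ∸ 1) ≡ 1 →
    ¬ Degenerate p (FiniteField.size F) d →
    ∃[ a ] ¬ PiPowDivides p (suc ((2 * n * (p ∸ 1)) / 3)) (weilSum F p n d a)
theorem3p1 F zero n d pr = contradiction pr ¬prime[0]
-- q = p^0 = 1 is impossible in a field with 0 ≠ 1.
theorem3p1 F p@(suc _) zero d pr char size≡ = contradiction refl (ℕ.<⇒≢ (CharacteristicP.0<n F p zero pr char size≡))
theorem3p1 F p@(suc p-1) n@(suc m) d pr char size≡ 0<d coprime nondegenerate =
  decidable-stable (FiniteFieldProperties.∃? F (¬? ∘ divides?)) (nondegenerate ∘ degenerate)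
  where
  K : ℕ
  K = suc ((2 * n * p-1) / 3)

  divides? : ∀ a → Dec (PiPowDivides p K (weilSum F p n d a))
  divides? a = CyclotomicIntegers.PiPowDivides? p-1 pr K (weilSum F p n d a)

  degenerate : ¬ (∃[ a ] ¬ PiPowDivides p K (weilSum F p n d a)) → Degenerate p (FiniteField.size F) d
  degenerate ¬∃ = allDivisible⇒degenerate F p-1 m d pr char size≡ 0<d coprime
    λ a → decidable-stable (divides? a) λ h → ¬∃ (a , h)
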